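{- As $m \to + \infty$, $$\mathsf{D}^{(4)} (\mathcal{B}^{(3)}_m) \sim \frac{16}{3 \sqrt 3} m^3,$$ i.e. the ratio of the two sides tends to $1$.
   Context: A sequence over a subset $X$ of an abelian group is a finite unordered sequence (multiset) of elements of $X$; its support is the set of distinct elements occurring in it. It is a minimal zero-sum sequence if its terms sum to $0$ and no non-empty proper subsequence sums to $0$. $\mathsf{D}^{(k)}(X)$ denotes the largest length of a minimal zero-sum sequence over $X$ whose support has exactly $k$ elements. $\mathcal{B}^{(3)}_m=\{(u_1,u_2,u_3)\in\mathbb{Z}^3 : u_1^2+u_2^2+u_3^2\le m^2\}$. -}

module Defs where

open import Data.Nat as ℕ using (ℕ; suc; _^_)
open import Data.Integer as ℤ using (ℤ; +_)
import Data.Integer.Properties as ℤP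
open import Data.Product using (_×_; _,_; Σ; ∃)
open import Data.Product.Properties using (≡-dec)
open import Data.List using (List; []; _∷_; foldr; length; deduplicate)
open import Data.List.Relation.Unary.All using (All)
open import Data.List.Relation.Binary.Sublist.Propositional using (_⊆_)
open import Relation.Binary.PropositionalEquality using (_≡_; _≢_)
open import Relation.Binary.Definitions using (DecidableEquality)

ℤ³ : Set
ℤ³ = ℤ × ℤ × ℤ

_≟³_ : DecidableEquality ℤ³
_≟³_ = ≡-dec ℤP._≟_ (≡-dec ℤP._≟_ ℤP._≟_)

0³ : ℤ³
0³ = (+ 0 , + 0 , + 0)

_+³_ : ℤ³ → ℤ³ → ℤ³
(a , b , c) +³ (x , y , z) = (a ℤ.+ x , b ℤ.+ y , c ℤ.+ z)

-- A sequence (multiset) is represented by a list; order is irrelevant for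
-- everything below (sum, length, support size, sub-multisets = sublists).
Seq : Set
Seq = List ℤ³

σ : Seq → ℤ³
σ = foldr _+³_ 0³

support : Seq → List ℤ³
support = deduplicate _≟³_

-- minimal zero-sum sequence: nonempty, sums to 0, and no nonempty proper
-- subsequence sums to 0 (a subsequence of full length is the whole sequence)
MinimalZeroSum : Seq → Set
MinimalZeroSum S =
  (S ≢ []) × (σ S ≡ 0³) ×
  (∀ T → T ⊆ S → T ≢ [] → σ T ≡ 0³ → length T ≡ length S)

InBall : ℕ → ℤ³ → Set
InBall m (u₁ , u₂ , u₃) = u₁ ℤ.* u₁ ℤ.+ u₂ ℤ.* u₂ ℤ.+ u₃ ℤ.* u₃ ℤ.≤ + (m ℕ.* m)

Admissible : ℕ → ℕ → Seq → Set
Admissible k m S = All (InBall m) S × MinimalZeroSum S × (length (support S) ≡ k)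

IsDk : ℕ → ℕ → ℕ → Set
IsDk k m d =
  (Σ Seq λ S → Admissible k m S × length S ≡ d) ×
  (∀ S → Admissible k m S → length S ℕ.≤ d)

{-# OPTIONS --safe #-}

-- Upper bound.  Four vectors in ℤ³ satisfy the relation whose coefficients are
-- their signed 3 × 3 minors.  If some minor is non-zero, every relation is
-- proportional to that one, so a minimal relation is no longer than the sum Δ
-- of the minors.  Applying the orthogonal 4 × 4 Hadamard matrix to the vectors
-- gives w₁, w₂, w₃ with |det (w₁, w₂, w₃)| = 4 |Δ| and Σ |wᵢ|² ≤ 16 m², hence
-- 27 Δ² ≤ 256 m⁶ by Hadamard's inequality and AM-GM.  If all minors vanish, the
-- vectors lie in a plane.  For a minimal relation a of length d the rounded
-- multiples ⌊t a / d⌋, for t running through the multiples of 4 below d, have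
-- pairwise distinct sums, and these stay within bounded distance (O(m)) of 0;
-- the plane has room for only O(m²) of them.
--
-- Lower bound.  A perturbation of the regular tetrahedron n (±1, ±1, ±1) has
-- coprime minors, each at least 4 n³, which therefore form a minimal relation.

module Submission where

open import Defs
import Algebra.Properties.AbelianGroup
open import Data.Bool using (if_then_else_)
open import Data.Fin as Fin using (Fin; toℕ)
open import Data.Fin.Patterns using (0F; 1F; 2F; 3F)
import Data.Fin.Properties as FinP
open import Data.Integer as ℤ using (ℤ; +_; -[1+_]; 0ℤ; ∣_∣; +≤+)
import Data.Integer.Properties as ℤP
open import Data.Integer.Solver using (module +-*-Solver)
open import Data.List as List
  using (List; []; _∷_; _++_; length; map; replicate; upTo; cartesianProduct; lookup)
import Data.List.Properties as ListP
open import Data.List.Membership.Propositional using (_∈_; find; lose)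
open import Data.List.Membership.Propositional.Properties
open import Data.List.Membership.Propositional.Properties.WithK using (unique∧set⇒bag)
open import Data.List.Relation.Binary.BagAndSetEquality using (∼bag⇒↭)
open import Data.List.Relation.Binary.Permutation.Propositional.Properties using (↭-length)
open import Data.List.Relation.Binary.Sublist.Propositional using (_⊆_; []; _∷_; _∷ʳ_)
import Data.List.Relation.Binary.Sublist.Propositional.Properties as SublistP
open import Data.List.Relation.Unary.All as All using (All; []; _∷_)
import Data.List.Relation.Unary.All.Properties as AllP
open import Data.List.Relation.Unary.AllPairs using ([]; _∷_)
open import Data.List.Relation.Unary.Any as Any using (Any; here; there)
import Data.List.Relation.Unary.Any.Properties as AnyP
open import Data.List.Relation.Unary.Unique.DecPropositional.Properties _≟³_
  using (deduplicate-!)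
open import Data.List.Relation.Unary.Unique.Propositional using (Unique)
open import Data.Nat as ℕ
  using (ℕ; zero; suc; _+_; _*_; _^_; _∸_; _≤_; _<_; _≥_; z≤n; s≤s)
open import Data.Nat.DivMod using (_/_; _%_; m≡m%n+[m/n]*n; m%n<n; m*n/n≡m; /-monoˡ-≤)
import Data.Nat.Properties as ℕP
import Data.Nat.Solver
open import Data.Product using (_×_; _,_; Σ; ∃; ∃₂; proj₁; proj₂)
open import Data.Sum using (_⊎_; inj₁; inj₂)
open import Data.Vec using (Vec; _∷_; [])
open import Function using (_∘_; _$_)
open import Function.Bundles using (mk⇔)
open import Relation.Binary.Definitions using (tri<; tri≈; tri>)
open import Relation.Binary.PropositionalEquality
open import Relation.Nullary using (Dec; yes; no; does; contradiction)
open import Relation.Nullary.Decidable using (map′; _×-dec_; _→-dec_; ¬?)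
open import Relation.Unary using (Decidable)

-- Integer vectors and the matching solver polynomials

module ℤGroup = Algebra.Properties.AbelianGroup ℤP.+-0-abelianGroup
open +-*-Solver
  using (Polynomial; ⟦_⟧; ⟦_⟧↓; var; con; prove; _:+_; _:*_; _:-_; :-_; solve; _:=_)
open Data.Nat.Solver.+-*-Solver using () renaming
  (solve to solveℕ; con to conℕ; _:+_ to _⊕_; _:*_ to _⊗_; _:^_ to _⊛_; _:=_ to _⊜_)

-- Stated over arbitrary operations so that the same formulas serve both for
-- integers and for the polynomial expressions of the ring solver.
module Formulas {A : Set} (_+_ _*_ _-_ : A → A → A) where

  Σ₄ : (Fin 4 → A) → A
  Σ₄ f = ((f 0F + f 1F) + f 2F) + f 3F

  dot : A × A × A → A × A × A → A
  dot (a , b , c) (x , y , z) = ((a * x) + (b * y)) + (c * z)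

  cross : A × A × A → A × A × A → A × A × A
  cross (a , b , c) (x , y , z) =
    ((b * z) - (c * y)) , ((c * x) - (a * z)) , ((a * y) - (b * x))

  det : A × A × A → A × A × A → A × A × A → A
  det u v w = dot u (cross v w)

  add sub : A × A × A → A × A × A → A × A × A
  add (a , b , c) (x , y , z) = (a + x) , (b + y) , (c + z)
  sub (a , b , c) (x , y , z) = (a - x) , (b - y) , (c - z)

  combination : (Fin 4 → A) → (Fin 4 → A × A × A) → A × A × A
  combination c v =
    Σ₄ (λ i → c i * proj₁ (v i)) ,
    Σ₄ (λ i → c i * proj₁ (proj₂ (v i))) ,
    Σ₄ (λ i → c i * proj₂ (proj₂ (v i)))

  -- The alternating signs of the cofactors are absorbed into the order of the arguments: two
  -- vectors are swapped in the cases `1F` and `3F`.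
  minor : (Fin 4 → A × A × A) → Fin 4 → A
  minor v 0F = det (v 1F) (v 2F) (v 3F)
  minor v 1F = det (v 0F) (v 3F) (v 2F)
  minor v 2F = det (v 0F) (v 1F) (v 3F)
  minor v 3F = det (v 0F) (v 2F) (v 1F)

  -- The non-constant rows of the 4 × 4 Hadamard matrix applied to v.
  hadamard₁ hadamard₂ hadamard₃ : (Fin 4 → A × A × A) → A × A × A
  hadamard₁ v = sub (add (v 0F) (v 1F)) (add (v 2F) (v 3F))
  hadamard₂ v = sub (add (v 0F) (v 2F)) (add (v 1F) (v 3F))
  hadamard₃ v = sub (add (v 0F) (v 3F)) (add (v 1F) (v 2F))

open Formulas ℤ._+_ ℤ._*_ ℤ._-_
open Formulas _+_ _*_ _∸_ using () renaming (Σ₄ to Σ₄ℕ)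
module P {n} = Formulas {Polynomial n} _:+_ _:*_ _:-_

module _ (c : Fin 4 → ℤ) (v : Fin 4 → ℤ³) where

  -- One numbering of variables serves all identities about four coefficients and four vectors;
  -- `coefficient` and `vector` name its entries. Identities without coefficients fill the first
  -- four places with zeros.
  environment : Vec ℤ 16
  environment =
    c 0F ∷ c 1F ∷ c 2F ∷ c 3F ∷
    proj₁ (v 0F) ∷ proj₁ (proj₂ (v 0F)) ∷ proj₂ (proj₂ (v 0F)) ∷
    proj₁ (v 1F) ∷ proj₁ (proj₂ (v 1F)) ∷ proj₂ (proj₂ (v 1F)) ∷
    proj₁ (v 2F) ∷ proj₁ (proj₂ (v 2F)) ∷ proj₂ (proj₂ (v 2F)) ∷
    proj₁ (v 3F) ∷ proj₁ (proj₂ (v 3F)) ∷ proj₂ (proj₂ (v 3F)) ∷ []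

coefficient : Fin 4 → Polynomial 16
coefficient 0F = var (Fin.# 0)
coefficient 1F = var (Fin.# 1)
coefficient 2F = var (Fin.# 2)
coefficient 3F = var (Fin.# 3)

vector : Fin 4 → Polynomial 16 × Polynomial 16 × Polynomial 16
vector 0F = var (Fin.# 4) , var (Fin.# 5) , var (Fin.# 6)
vector 1F = var (Fin.# 7) , var (Fin.# 8) , var (Fin.# 9)
vector 2F = var (Fin.# 10) , var (Fin.# 11) , var (Fin.# 12)
vector 3F = var (Fin.# 13) , var (Fin.# 14) , var (Fin.# 15)

module _ {n} (ρ : Vec ℤ n) where

  ⟦_⟧³ ⟦_⟧³↓ : Polynomial n × Polynomial n × Polynomial n → ℤ³
  ⟦ p , q , r ⟧³  = ⟦ p ⟧ ρ , ⟦ q ⟧ ρ , ⟦ r ⟧ ρ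
  ⟦ p , q , r ⟧³↓ = ⟦ p ⟧↓ ρ , ⟦ q ⟧↓ ρ , ⟦ r ⟧↓ ρ

  prove³ : ∀ p q → ⟦ p ⟧³↓ ≡ ⟦ q ⟧³↓ → ⟦ p ⟧³ ≡ ⟦ q ⟧³
  prove³ (p₁ , p₂ , p₃) (q₁ , q₂ , q₃) eq = cong₂ _,_
    (prove ρ p₁ q₁ (cong proj₁ eq))
    (cong₂ _,_ (prove ρ p₂ q₂ (cong (proj₁ ∘ proj₂) eq))
               (prove ρ p₃ q₃ (cong (proj₂ ∘ proj₂) eq)))

-- The relation between four vectors

-- Each coordinate is, up to sign, the expansion of a 4 × 4 determinant in which one row of
-- coordinates occurs twice.
minors-relation : ∀ v → combination (minor v) v ≡ 0³
minors-relation v = prove³ (environment (λ _ → 0ℤ) v)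
  (P.combination (P.minor vector) vector) (con 0ℤ , con 0ℤ , con 0ℤ) refl

module _ {c : Fin 4 → ℤ} {v : Fin 4 → ℤ³} (rel : combination c v ≡ 0³) where

  private
    lhs rhs : Fin 4 → Fin 4 → Polynomial 16
    lhs p q = P.dot (P.combination coefficient vector) (P.cross (vector p) (vector q))
    rhs i j = coefficient i :* P.minor vector j :- coefficient j :* P.minor vector i

    -- Pairing the relation with v p × v q eliminates v p and v q from it.
    eliminate : ∀ i j p q →
      dot (combination c v) (cross (v p) (v q)) ≡ c i ℤ.* minor v j ℤ.- c j ℤ.* minor v i →
      c i ℤ.* minor v j ≡ c j ℤ.* minor v i
    eliminate i j p q eq = ℤP.i-j≡0⇒i≡j _ _ (trans (sym eq)
      (cong (λ u → dot u (cross (v p) (v q))) rel))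

  -- The two indices other than `i` and `j` are eliminated. Of the two orders of a pair, the solver
  -- treats the one whose sign comes out right when the eliminated indices are increasing; the other
  -- follows by symmetry.
  relation-∝-minors : ∀ i j → c i ℤ.* minor v j ≡ c j ℤ.* minor v i
  relation-∝-minors 0F 0F = refl
  relation-∝-minors 0F 1F = sym (relation-∝-minors 1F 0F)
  relation-∝-minors 0F 2F = eliminate 0F 2F 1F 3F
    (prove (environment c v) (lhs 1F 3F) (rhs 0F 2F) refl)
  relation-∝-minors 0F 3F = sym (relation-∝-minors 3F 0F)
  relation-∝-minors 1F 0F = eliminate 1F 0F 2F 3F
    (prove (environment c v) (lhs 2F 3F) (rhs 1F 0F) refl)
  relation-∝-minors 1F 1F = refl
  relation-∝-minors 1F 2F = sym (relation-∝-minors 2F 1F)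
  relation-∝-minors 1F 3F = eliminate 1F 3F 0F 2F
    (prove (environment c v) (lhs 0F 2F) (rhs 1F 3F) refl)
  relation-∝-minors 2F 0F = sym (relation-∝-minors 0F 2F)
  relation-∝-minors 2F 1F = eliminate 2F 1F 0F 3F
    (prove (environment c v) (lhs 0F 3F) (rhs 2F 1F) refl)
  relation-∝-minors 2F 2F = refl
  relation-∝-minors 2F 3F = sym (relation-∝-minors 3F 2F)
  relation-∝-minors 3F 0F = eliminate 3F 0F 1F 2F
    (prove (environment c v) (lhs 1F 2F) (rhs 3F 0F) refl)
  relation-∝-minors 3F 1F = sym (relation-∝-minors 1F 3F)
  relation-∝-minors 3F 2F = eliminate 3F 2F 0F 1F
    (prove (environment c v) (lhs 0F 1F) (rhs 3F 2F) refl)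
  relation-∝-minors 3F 3F = refl

-- Up to sign, the sum of the minors is the determinant of the 4 × 4 matrix with rows (1, vᵢ). The
-- Hadamard matrix has determinant ±16 and turns these rows into (4, s) and (0, wᵢ), so ±16 Δ = 4
-- det (w₁, w₂, w₃).
hadamard-det : ∀ v → det (hadamard₁ v) (hadamard₂ v) (hadamard₃ v) ≡ ℤ.- (+ 4) ℤ.* Σ₄ (minor v)
hadamard-det v = prove (environment (λ _ → 0ℤ) v)
  (P.det (P.hadamard₁ vector) (P.hadamard₂ vector) (P.hadamard₃ vector))
  (con (ℤ.- (+ 4)) :* P.Σ₄ (P.minor vector)) refl

-- The volume of a tetrahedron in a ball

0≤*0≤ : ∀ {i j} → 0ℤ ℤ.≤ i → 0ℤ ℤ.≤ j → 0ℤ ℤ.≤ i ℤ.* j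
0≤*0≤ (+≤+ {n = m} _) (+≤+ {n = n} _) rewrite sym (ℤP.pos-* m n) = +≤+ z≤n

0≤i*i : ∀ i → 0ℤ ℤ.≤ i ℤ.* i
0≤i*i (+ n)      = 0≤*0≤ {+ n} (+≤+ z≤n) (+≤+ z≤n)
0≤i*i (-[1+ n ]) = +≤+ z≤n

0≤dot : ∀ u → 0ℤ ℤ.≤ dot u u
0≤dot (x , y , z) = ℤP.+-mono-≤ (ℤP.+-mono-≤ (0≤i*i x) (0≤i*i y)) (0≤i*i z)

≤-by-difference : ∀ {i j k} → j ℤ.- i ≡ k → 0ℤ ℤ.≤ k → i ℤ.≤ j
≤-by-difference eq 0≤k = ℤP.0≤i-j⇒j≤i (subst (0ℤ ℤ.≤_) (sym eq) 0≤k)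

-- Hadamard's inequality. Lagrange's identity, applied to `v`, `w` and then to `u`, `v × w`, writes
-- the difference as a sum of squares |u × (v × w)|² + |u|² (v · w)².
det²≤ : ∀ u v w → det u v w ℤ.* det u v w ℤ.≤ dot u u ℤ.* dot v v ℤ.* dot w w
det²≤ u@(a , b , c) v@(d , e , f) w@(g , h , i) = ≤-by-difference
  (solve 9 (λ a b c d e f g h i →
    let u = a , b , c; v = d , e , f; w = g , h , i in
    P.dot u u :* P.dot v v :* P.dot w w :- P.det u v w :* P.det u v w
    := P.dot (P.cross u (P.cross v w)) (P.cross u (P.cross v w))
       :+ P.dot u u :* (P.dot v w :* P.dot v w)) refl a b c d e f g h i)
  (ℤP.+-mono-≤ (0≤dot (cross u (cross v w))) (0≤*0≤ (0≤dot u) (0≤i*i (dot v w))))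

-- With s = x + y + z, twice the difference is s ∑ (x - y)² + 6 ∑ x (y - z)², both sums being
-- cyclic; doubling avoids a fraction.
am-gm : ∀ {x y z} → 0ℤ ℤ.≤ x → 0ℤ ℤ.≤ y → 0ℤ ℤ.≤ z →
        + 27 ℤ.* (x ℤ.* y ℤ.* z) ℤ.≤ (x ℤ.+ y ℤ.+ z) ℤ.* (x ℤ.+ y ℤ.+ z) ℤ.* (x ℤ.+ y ℤ.+ z)
am-gm {x} {y} {z} 0≤x 0≤y 0≤z = ℤP.*-cancelˡ-≤-pos _ _ (+ 2) $ ≤-by-difference
  (solve 3 (λ x y z → let s = x :+ y :+ z in
    con (+ 2) :* (s :* s :* s) :- con (+ 2) :* (con (+ 27) :* (x :* y :* z))
    := s :* ((x :- y) :* (x :- y) :+ (y :- z) :* (y :- z) :+ (z :- x) :* (z :- x))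
       :+ con (+ 6) :* (x :* ((y :- z) :* (y :- z)) :+ y :* ((z :- x) :* (z :- x))
                        :+ z :* ((x :- y) :* (x :- y)))) refl x y z)
  (ℤP.+-mono-≤
    (0≤*0≤ (ℤP.+-mono-≤ (ℤP.+-mono-≤ 0≤x 0≤y) 0≤z)
           (ℤP.+-mono-≤ (ℤP.+-mono-≤ (0≤i*i (x ℤ.- y)) (0≤i*i (y ℤ.- z))) (0≤i*i (z ℤ.- x))))
    (0≤*0≤ {+ 6} (+≤+ z≤n)
      (ℤP.+-mono-≤ (ℤP.+-mono-≤ (0≤*0≤ 0≤x (0≤i*i (y ℤ.- z))) (0≤*0≤ 0≤y (0≤i*i (z ℤ.- x))))
                   (0≤*0≤ 0≤z (0≤i*i (x ℤ.- y))))))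

cube-mono : ∀ {i j} → 0ℤ ℤ.≤ i → i ℤ.≤ j → i ℤ.* i ℤ.* i ℤ.≤ j ℤ.* j ℤ.* j
cube-mono (+≤+ {n = m} _) (+≤+ {n = n} m≤n)
  rewrite sym (ℤP.pos-* m m) | sym (ℤP.pos-* (m * m) m)
        | sym (ℤP.pos-* n n) | sym (ℤP.pos-* (n * n) n)
  = +≤+ (ℕP.*-mono-≤ (ℕP.*-mono-≤ m≤n m≤n) m≤n)

-- Parseval's identity for the Hadamard matrix, whose rows are orthogonal of squared length 4; `s`
-- comes from the constant row.
hadamard-norms : ∀ v →
  let s = add (add (v 0F) (v 1F)) (add (v 2F) (v 3F)) in
  + 4 ℤ.* Σ₄ (λ i → dot (v i) (v i)) ℤ.-
  (dot (hadamard₁ v) (hadamard₁ v) ℤ.+ dot (hadamard₂ v) (hadamard₂ v)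
   ℤ.+ dot (hadamard₃ v) (hadamard₃ v))
  ≡ dot s s
hadamard-norms v = prove (environment (λ _ → 0ℤ) v)
  (con (+ 4) :* P.Σ₄ (λ i → P.dot (vector i) (vector i)) :-
   (P.dot w₁ w₁ :+ P.dot w₂ w₂ :+ P.dot w₃ w₃))
  (P.dot s s) refl
  where
  w₁ = P.hadamard₁ vector
  w₂ = P.hadamard₂ vector
  w₃ = P.hadamard₃ vector
  s = P.add (P.add (vector 0F) (vector 1F)) (P.add (vector 2F) (vector 3F))

Σ₄-minors-bound : ∀ {M} v → (∀ i → dot (v i) (v i) ℤ.≤ M) →
  + 27 ℤ.* (Σ₄ (minor v) ℤ.* Σ₄ (minor v)) ℤ.≤ + 256 ℤ.* (M ℤ.* M ℤ.* M)
-- The factor 16 is the square of the -4 in `hadamard-det`. It cancels against (16 M)³ and leaves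
-- 256 M³.
Σ₄-minors-bound {M} v v≤M = ℤP.*-cancelˡ-≤-pos _ _ (+ 16) $ begin
  + 16 ℤ.* (+ 27 ℤ.* (Δ ℤ.* Δ))
    ≡⟨ solve 1 (λ Δ → con (+ 16) :* (con (+ 27) :* (Δ :* Δ))
      := con (+ 27) :* ((con (ℤ.- (+ 4)) :* Δ) :* (con (ℤ.- (+ 4)) :* Δ))) refl Δ ⟩
  + 27 ℤ.* ((ℤ.- (+ 4) ℤ.* Δ) ℤ.* (ℤ.- (+ 4) ℤ.* Δ))
    ≡⟨ cong (λ D → + 27 ℤ.* (D ℤ.* D)) (hadamard-det v) ⟨
  + 27 ℤ.* (det w₁ w₂ w₃ ℤ.* det w₁ w₂ w₃)
    ≤⟨ ℤP.*-monoˡ-≤-nonNeg (+ 27) (det²≤ w₁ w₂ w₃) ⟩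
  + 27 ℤ.* (dot w₁ w₁ ℤ.* dot w₂ w₂ ℤ.* dot w₃ w₃)
    ≤⟨ am-gm (0≤dot w₁) (0≤dot w₂) (0≤dot w₃) ⟩
  W ℤ.* W ℤ.* W
    ≤⟨ cube-mono (ℤP.+-mono-≤ (ℤP.+-mono-≤ (0≤dot w₁) (0≤dot w₂)) (0≤dot w₃)) W≤16M ⟩
  (+ 16 ℤ.* M) ℤ.* (+ 16 ℤ.* M) ℤ.* (+ 16 ℤ.* M)
    ≡⟨ solve 1 (λ M → (con (+ 16) :* M) :* (con (+ 16) :* M) :* (con (+ 16) :* M)
      := con (+ 16) :* (con (+ 256) :* (M :* M :* M))) refl M ⟩
  + 16 ℤ.* (+ 256 ℤ.* (M ℤ.* M ℤ.* M)) ∎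
  where
  open ℤP.≤-Reasoning
  Δ = Σ₄ (minor v)
  w₁ = hadamard₁ v
  w₂ = hadamard₂ v
  w₃ = hadamard₃ v
  W = dot w₁ w₁ ℤ.+ dot w₂ w₂ ℤ.+ dot w₃ w₃
  W≤16M : W ℤ.≤ + 16 ℤ.* M
  W≤16M = begin
    W
      ≤⟨ ≤-by-difference (hadamard-norms v) (0≤dot (add (add (v 0F) (v 1F)) (add (v 2F) (v 3F)))) ⟩
    + 4 ℤ.* Σ₄ (λ i → dot (v i) (v i))
      ≤⟨ ℤP.*-monoˡ-≤-nonNeg (+ 4) (ℤP.+-mono-≤
        (ℤP.+-mono-≤ (ℤP.+-mono-≤ (v≤M 0F) (v≤M 1F)) (v≤M 2F)) (v≤M 3F)) ⟩
    + 4 ℤ.* (M ℤ.+ M ℤ.+ M ℤ.+ M)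
      ≡⟨ solve 1 (λ M → con (+ 4) :* (M :+ M :+ M :+ M) := con (+ 16) :* M) refl M ⟩
    + 16 ℤ.* M                            ∎

-- Sequences as families of multiplicities

δ : Fin 4 → Fin 4 → ℕ
δ j i = if does (j Fin.≟ i) then 1 else 0

count : List (Fin 4) → Fin 4 → ℕ
count []      i = 0
count (j ∷ L) i = δ j i + count L i

Σ₄-count : ∀ L → Σ₄ℕ (count L) ≡ length L
Σ₄-count []      = refl
Σ₄-count (j ∷ L) = trans (step j (count L)) (cong suc (Σ₄-count L))
  where
  step : ∀ j (c : Fin 4 → ℕ) → Σ₄ℕ (λ i → δ j i + c i) ≡ suc (Σ₄ℕ c)
  step 0F c = refl
  step 1F c rewrite ℕP.+-suc (c 0F) (c 1F) = refl
  step 2F c rewrite ℕP.+-suc (c 0F + c 1F) (c 2F) = refl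
  step 3F c rewrite ℕP.+-suc (c 0F + c 1F + c 2F) (c 3F) = refl

σ-map : ∀ v L → σ (map v L) ≡ combination (λ i → + count L i) v
σ-map v []      = refl
σ-map v (j ∷ L) = trans (cong (v j +³_) (σ-map v L)) (step j)
  where
  ρ = environment (λ i → + count L i) v
  lhs rhs : Fin 4 → Polynomial 16 × Polynomial 16 × Polynomial 16
  lhs j = P.add (vector j) (P.combination coefficient vector)
  rhs j = P.combination (λ i → con (+ δ j i) :+ coefficient i) vector
  -- Splitting into the four values of `j` lets `vector j` and `δ j` compute, as the solver
  -- requires.
  step : ∀ j → v j +³ combination (λ i → + count L i) v ≡ combination (λ i → + count (j ∷ L) i) v
  step 0F = prove³ ρ (lhs 0F) (rhs 0F) refl
  step 1F = prove³ ρ (lhs 1F) (rhs 1F) refl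
  step 2F = prove³ ρ (lhs 2F) (rhs 2F) refl
  step 3F = prove³ ρ (lhs 3F) (rhs 3F) refl

count-mono : ∀ {K L} → K ⊆ L → ∀ i → count K i ≤ count L i
count-mono []                     i = z≤n
count-mono (j ∷ʳ K⊆L)             i = ℕP.m≤n⇒m≤o+n (δ j i) (count-mono K⊆L i)
count-mono {j ∷ _} (refl ∷ K⊆L)   i = ℕP.+-monoʳ-≤ (δ j i) (count-mono K⊆L i)

δ≤ : ∀ j (b : Fin 4 → ℕ) → 0 < b j → ∀ i → δ j i ≤ b i
δ≤ j b 0<bⱼ i with j Fin.≟ i
... | yes refl = 0<bⱼ
... | no  _    = z≤n

-- Greedy choice: an entry `j` is kept as long as `b j` is positive. When it is dropped, `b j` is
-- zero, so the rest of the list still suffices. Through this, subrelations become subsequences.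
select : ∀ L (b : Fin 4 → ℕ) → (∀ i → b i ≤ count L i) →
         ∃ λ K → K ⊆ L × (∀ i → count K i ≡ b i)
select []      b b≤ = [] , [] , λ i → sym (ℕP.n≤0⇒n≡0 (b≤ i))
select (j ∷ L) b b≤ with b j in bⱼ≡
... | zero =
  let K , K⊆L , count≡ = select L b shrink in K , j ∷ʳ K⊆L , count≡
  where
  shrink : ∀ i → b i ≤ count L i
  shrink i with j Fin.≟ i | b≤ i
  ... | yes refl | _  = subst (ℕ._≤ count L i) (sym bⱼ≡) z≤n
  ... | no  _    | b≤ = b≤
... | suc _ =
  let K , K⊆L , count≡ = select L (λ i → b i ∸ δ j i) (λ i → ℕP.m≤n+o⇒m∸n≤o (b i) (δ j i) (b≤ i))
  in j ∷ K , refl ∷ K⊆L , λ i → trans (cong (δ j i ℕ.+_) (count≡ i))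
       (ℕP.m+[n∸m]≡n (δ≤ j b (subst (0 ℕ.<_) (sym bⱼ≡) ℕ.z<s) i))

⊆-map⁻ : ∀ {A B : Set} (f : A → B) {T} L → T ⊆ map f L → ∃ λ K → K ⊆ L × T ≡ map f K
⊆-map⁻ f []      []           = [] , [] , refl
⊆-map⁻ f (x ∷ L) (_ ∷ʳ T⊆)   = let K , K⊆L , eq = ⊆-map⁻ f L T⊆ in K , x ∷ʳ K⊆L , eq
⊆-map⁻ f (x ∷ L) (refl ∷ T⊆) =
  let K , K⊆L , eq = ⊆-map⁻ f L T⊆ in x ∷ K , refl ∷ K⊆L , cong (f x ∷_) eq

Relation : (Fin 4 → ℕ) → (Fin 4 → ℤ³) → Set
Relation a v = combination (λ i → + a i) v ≡ 0³

-- The counterpart of `MinimalZeroSum` for multiplicities. Since `b` is bounded by `a` pointwise,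
-- equal sums mean that `b` is all of `a`.
MinimalRelation : (Fin 4 → ℕ) → (Fin 4 → ℤ³) → Set
MinimalRelation a v = 0 < Σ₄ℕ a × Relation a v ×
  (∀ b → (∀ i → b i ≤ a i) → Relation b v → 0 < Σ₄ℕ b → Σ₄ℕ b ≡ Σ₄ℕ a)

Σ₄-cong : ∀ {a b : Fin 4 → ℕ} → (∀ i → a i ≡ b i) → Σ₄ℕ a ≡ Σ₄ℕ b
Σ₄-cong eq = cong₂ _+_ (cong₂ _+_ (cong₂ _+_ (eq 0F) (eq 1F)) (eq 2F)) (eq 3F)

Relation-resp : ∀ {a b v} → (∀ i → a i ≡ b i) → Relation a v → Relation b v
Relation-resp {a} {b} eq rel with eq 0F | eq 1F | eq 2F | eq 3F
... | e₀ | e₁ | e₂ | e₃ rewrite e₀ | e₁ | e₂ | e₃ = rel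

nonempty⇒0<length : ∀ {A : Set} {L : List A} → L ≢ [] → 0 < length L
nonempty⇒0<length {L = []}    ne = contradiction refl ne
nonempty⇒0<length {L = _ ∷ _} ne = ℕ.z<s

0<length⇒nonempty : ∀ {A : Set} {L : List A} → 0 < length L → L ≢ []
0<length⇒nonempty () refl

minimal⇒MinimalRelation : ∀ v L → MinimalZeroSum (map v L) → MinimalRelation (count L) v
minimal⇒MinimalRelation v L (L≢[] , σ≡0 , minimal) =
  subst (0 ℕ.<_) (trans (ListP.length-map v L) (sym (Σ₄-count L))) (nonempty⇒0<length L≢[]) ,
  trans (sym (σ-map v L)) σ≡0 ,
  minimal′
  where
  minimal′ : ∀ b → (∀ i → b i ≤ count L i) → Relation b v → 0 < Σ₄ℕ b → Σ₄ℕ b ≡ Σ₄ℕ (count L)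
  minimal′ b b≤ rel 0<Σb with select L b b≤
  ... | K , K⊆L , count≡ = begin
    Σ₄ℕ b               ≡⟨ lengthK ⟨
    length (map v K)    ≡⟨ minimal (map v K) (SublistP.map⁺ v K⊆L)
                             (0<length⇒nonempty (subst (0 ℕ.<_) (sym lengthK) 0<Σb))
                             (trans (σ-map v K) (Relation-resp {v = v} (sym ∘ count≡) rel)) ⟩
    length (map v L)    ≡⟨ ListP.length-map v L ⟩
    length L            ≡⟨ Σ₄-count L ⟨
    Σ₄ℕ (count L)       ∎
    where
    open ≡-Reasoning
    lengthK : length (map v K) ≡ Σ₄ℕ b
    lengthK = trans (ListP.length-map v K) (trans (sym (Σ₄-count K)) (Σ₄-cong count≡))

MinimalRelation⇒minimal : ∀ v L → MinimalRelation (count L) v → MinimalZeroSum (map v L)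
MinimalRelation⇒minimal v L (0<Σ , rel , minimal) =
  0<length⇒nonempty (subst (0 ℕ.<_) (trans (Σ₄-count L) (sym (ListP.length-map v L))) 0<Σ) ,
  trans (σ-map v L) rel ,
  minimal′
  where
  minimal′ : ∀ T → T ⊆ map v L → T ≢ [] → σ T ≡ 0³ → length T ≡ length (map v L)
  minimal′ T T⊆ T≢[] σT≡0 with ⊆-map⁻ v L T⊆
  ... | K , K⊆L , refl = begin
    length (map v K)   ≡⟨ trans (ListP.length-map v K) (sym (Σ₄-count K)) ⟩
    Σ₄ℕ (count K)      ≡⟨ minimal (count K) (count-mono K⊆L) (trans (sym (σ-map v K)) σT≡0)
                           (subst (0 ℕ.<_) (trans (ListP.length-map v K) (sym (Σ₄-count K)))
                             (nonempty⇒0<length T≢[])) ⟩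
    Σ₄ℕ (count L)      ≡⟨ trans (Σ₄-count L) (sym (ListP.length-map v L)) ⟩
    length (map v L)   ∎
    where open ≡-Reasoning

Σ₄-mono : ∀ {a b : Fin 4 → ℕ} → (∀ i → a i ≤ b i) → Σ₄ℕ a ≤ Σ₄ℕ b
Σ₄-mono a≤b = ℕP.+-mono-≤ (ℕP.+-mono-≤ (ℕP.+-mono-≤ (a≤b 0F) (a≤b 1F)) (a≤b 2F)) (a≤b 3F)

≤Σ₄ : ∀ (a : Fin 4 → ℕ) i → a i ≤ Σ₄ℕ a
≤Σ₄ a 0F = ℕP.m≤n⇒m≤n+o (a 3F) (ℕP.m≤n⇒m≤n+o (a 2F) (ℕP.m≤m+n (a 0F) (a 1F)))
≤Σ₄ a 1F = ℕP.m≤n⇒m≤n+o (a 3F) (ℕP.m≤n⇒m≤n+o (a 2F) (ℕP.m≤n+m (a 1F) (a 0F)))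
≤Σ₄ a 2F = ℕP.m≤n⇒m≤n+o (a 3F) (ℕP.m≤n+m (a 2F) (a 0F + a 1F))
≤Σ₄ a 3F = ℕP.m≤n+m (a 3F) (a 0F + a 1F + a 2F)

Σ₄-zero : ∀ {a : Fin 4 → ℕ} → (∀ i → a i ≡ 0) → Σ₄ℕ a ≡ 0
Σ₄-zero a≡0 = Σ₄-cong {b = λ _ → 0} a≡0

-- Four vectors spanning ℤ³ over ℚ

-- Of two proportional families one dominates the other pointwise, and entry `j` decides which. If
-- it is `a` that dominates, `d` is a nonzero subrelation and minimality gives equal sums.
minimal-∝⇒≤ : ∀ {a d v} → MinimalRelation a v → Relation d v →
  ∀ j → 0 < d j → (∀ i → a i * d j ≡ a j * d i) → Σ₄ℕ a ≤ Σ₄ℕ d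
minimal-∝⇒≤ {a} {d} (_ , _ , minimal) rel j 0<dⱼ a∝d with ℕP.≤-total (a j) (d j)
... | inj₁ aⱼ≤dⱼ = Σ₄-mono λ i → ℕP.*-cancelʳ-≤ (a i) (d i) (d j) {{ℕ.>-nonZero 0<dⱼ}}
  (ℕP.≤-trans (ℕP.≤-reflexive (a∝d i))
    (ℕP.≤-trans (ℕP.*-monoˡ-≤ (d i) aⱼ≤dⱼ) (ℕP.≤-reflexive (ℕP.*-comm (d j) (d i)))))
... | inj₂ dⱼ≤aⱼ = ℕP.≤-reflexive (sym (minimal d d≤a rel (ℕP.<-≤-trans 0<dⱼ (≤Σ₄ d j))))
  where
  d≤a : ∀ i → d i ≤ a i
  d≤a i = ℕP.*-cancelˡ-≤ (a j) {{ℕ.>-nonZero (ℕP.<-≤-trans 0<dⱼ dⱼ≤aⱼ)}}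
    (ℕP.≤-trans (ℕP.≤-reflexive (sym (a∝d i)))
      (ℕP.≤-trans (ℕP.*-monoʳ-≤ (a i) dⱼ≤aⱼ) (ℕP.≤-reflexive (ℕP.*-comm (a i) (a j)))))

combination-cong : ∀ {c e} v → (∀ i → c i ≡ e i) → combination c v ≡ combination e v
combination-cong v eq rewrite eq 0F | eq 1F | eq 2F | eq 3F = refl

0<i⇒0<∣i∣ : ∀ {i} → 0ℤ ℤ.< i → 0 < ∣ i ∣
0<i⇒0<∣i∣ (ℤ.+<+ 0<n) = 0<n

-- One positive entry forces all of `e` to be nonnegative: `a j` is nonzero, as otherwise all of `a`
-- would vanish, and each `e i` then has the sign of `a i`. Hence `e` can be read as a family of
-- multiplicities.
minimal-∝-positive⇒≤ : ∀ {a v} (e : Fin 4 → ℤ) → MinimalRelation a v → combination e v ≡ 0³ →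
  ∀ j → 0ℤ ℤ.< e j → (∀ i → + a i ℤ.* e j ≡ + a j ℤ.* e i) → Σ₄ℕ a ≤ ∣ Σ₄ e ∣
minimal-∝-positive⇒≤ {a} {v} e minimal@(0<Σa , _) rel j 0<eⱼ a∝e =
  ℕP.≤-trans (minimal-∝⇒≤ {a} {d} {v} minimal (trans (combination-cong v +d≡e) rel) j 0<dⱼ a∝d)
             (ℕP.≤-reflexive (cong ∣_∣ +Σd≡Σe))
  where
  d = λ i → ∣ e i ∣
  a∝d : ∀ i → a i * d j ≡ a j * d i
  a∝d i = trans (sym (ℤP.abs-* (+ a i) (e j))) (trans (cong ∣_∣ (a∝e i)) (ℤP.abs-* (+ a j) (e i)))
  0<dⱼ : 0 < d j
  0<dⱼ = 0<i⇒0<∣i∣ 0<eⱼ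
  aⱼ≢0 : a j ≢ 0
  aⱼ≢0 aⱼ≡0 = ℕP.<⇒≢ 0<Σa (sym (Σ₄-zero λ i → ℕP.m*n≡0⇒m≡0 (a i) (d j) {{ℕ.>-nonZero 0<dⱼ}}
    (trans (a∝d i) (cong (ℕ._* d i) aⱼ≡0))))
  0≤e : ∀ i → 0ℤ ℤ.≤ e i
  0≤e i = ℤP.*-cancelˡ-≤-pos 0ℤ (e i) (+ a j) {{ℤ.positive (ℤ.+<+ (ℕP.n≢0⇒n>0 aⱼ≢0))}}
    (subst₂ ℤ._≤_ (sym (ℤP.*-zeroʳ (+ a j))) (a∝e i) (0≤*0≤ {+ a i} (+≤+ z≤n) (ℤP.<⇒≤ 0<eⱼ)))
  +d≡e : ∀ i → + d i ≡ e i
  +d≡e i = ℤP.0≤i⇒+∣i∣≡i (0≤e i)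
  +Σd≡Σe : + Σ₄ℕ d ≡ Σ₄ e
  +Σd≡Σe = cong₂ ℤ._+_ (cong₂ ℤ._+_ (cong₂ ℤ._+_ (+d≡e 0F) (+d≡e 1F)) (+d≡e 2F)) (+d≡e 3F)

-- If the given minor is negative, the negated minors form the relation to compare with; the
-- absolute value of their sum is the same.
nondegenerate-bound : ∀ {a v} → MinimalRelation a v → ∀ j → minor v j ≢ 0ℤ →
                      Σ₄ℕ a ≤ ∣ Σ₄ (minor v) ∣
nondegenerate-bound {a} {v} minimal@(_ , rel , _) j mⱼ≢0 with ℤP.<-cmp 0ℤ (minor v j)
... | tri< 0<mⱼ _ _ = minimal-∝-positive⇒≤ {a} {v} (minor v) minimal (minors-relation v) j 0<mⱼ
                        (λ i → relation-∝-minors {λ k → + a k} {v} rel i j)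
... | tri≈ _ 0≡mⱼ _ = contradiction (sym 0≡mⱼ) mⱼ≢0
... | tri> _ _ mⱼ<0 = subst (Σ₄ℕ a ℕ.≤_) (trans (cong ∣_∣ Σ-neg) (ℤP.∣-i∣≡∣i∣ (Σ₄ (minor v))))
  (minimal-∝-positive⇒≤ {a} {v} (λ i → ℤ.- minor v i) minimal neg-rel j (ℤP.neg-mono-< mⱼ<0)
    (λ i → trans (sym (ℤP.neg-distribʳ-* (+ a i) (minor v j)))
      (trans (cong ℤ.-_ (relation-∝-minors {λ k → + a k} {v} rel i j))
        (ℤP.neg-distribʳ-* (+ a j) (minor v i)))))
  where
  ρ = environment (minor v) v
  Σ-neg : Σ₄ (λ i → ℤ.- minor v i) ≡ ℤ.- Σ₄ (minor v)
  Σ-neg = prove ρ (P.Σ₄ (λ i → :- coefficient i)) (:- P.Σ₄ coefficient) refl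
  neg-rel : combination (λ i → ℤ.- minor v i) v ≡ 0³
  neg-rel = trans
    (prove³ ρ (P.combination (λ i → :- coefficient i) vector)
      (let x , y , z = P.combination coefficient vector in (:- x) , (:- y) , (:- z)) refl)
    (cong (λ (x , y , z) → (ℤ.- x , ℤ.- y , ℤ.- z)) (minors-relation v))

-- Coplanar vectors

annihilates : ∀ t {p} → p ≢ 0³ → (t ℤ.* proj₁ p , t ℤ.* proj₁ (proj₂ p) , t ℤ.* proj₂ (proj₂ p)) ≡
  0³ → t ≡ 0ℤ
annihilates t {p} p≢0 tp≡0 with t ℤ.≟ 0ℤ
... | yes t≡0 = t≡0
... | no  t≢0 = contradiction
  (cong₂ _,_ (cancel (cong proj₁ tp≡0)) (cong₂ _,_ (cancel (cong (proj₁ ∘ proj₂) tp≡0))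
    (cancel (cong (proj₂ ∘ proj₂) tp≡0)))) p≢0
  where
  cancel : ∀ {i} → t ℤ.* i ≡ 0ℤ → i ≡ 0ℤ
  cancel ti≡0 with ℤP.i*j≡0⇒i≡0∨j≡0 t ti≡0
  ... | inj₁ t≡0 = contradiction t≡0 t≢0
  ... | inj₂ i≡0 = i≡0

cross-cross : ∀ (n p q : ℤ³) → let x , y , z = p ; x′ , y′ , z′ = q in
  cross n (cross p q) ≡ sub (dot n q ℤ.* x , dot n q ℤ.* y , dot n q ℤ.* z)
                            (dot n p ℤ.* x′ , dot n p ℤ.* y′ , dot n p ℤ.* z′)
cross-cross (a , b , c) (d , e , f) (g , h , i) =
  prove³ (a ∷ b ∷ c ∷ d ∷ e ∷ f ∷ g ∷ h ∷ i ∷ [])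
    (P.cross n (P.cross p q))
    (let x , y , z = p ; x′ , y′ , z′ = q in
     P.sub (P.dot n q :* x , P.dot n q :* y , P.dot n q :* z)
           (P.dot n p :* x′ , P.dot n p :* y′ , P.dot n p :* z′))
    refl
  where
  n p q : Polynomial 9 × Polynomial 9 × Polynomial 9
  n = var (Fin.# 0) , var (Fin.# 1) , var (Fin.# 2)
  p = var (Fin.# 3) , var (Fin.# 4) , var (Fin.# 5)
  q = var (Fin.# 6) , var (Fin.# 7) , var (Fin.# 8)

infix 4 _⊥_
_⊥_ : ℤ³ → ℤ³ → Set
n ⊥ u = dot n u ≡ 0ℤ

⊥0 : ∀ n → n ⊥ 0³
⊥0 (a , b , c) = solve 3 (λ a b c → P.dot (a , b , c) (con 0ℤ , con 0ℤ , con 0ℤ) := con 0ℤ)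
  refl a b c

-- By the triple product expansion `cross-cross`, (n · q) p = (n · p) q = 0, and `p` is nonzero.
parallel⇒⊥ : ∀ {n p q} → p ≢ 0³ → cross p q ≡ 0³ → n ⊥ p → n ⊥ q
parallel⇒⊥ {n} {p} {q} p≢0 p∥q n⊥p = annihilates (dot n q) p≢0
  (trans (sym minus-zero) (trans (sym (cross-cross n p q)) n×0))
  where
  minus-zero : sub (dot n q ℤ.* proj₁ p , dot n q ℤ.* proj₁ (proj₂ p) , dot n q ℤ.* proj₂ (proj₂ p))
    (dot n p ℤ.* proj₁ q , dot n p ℤ.* proj₁ (proj₂ q) , dot n p ℤ.* proj₂ (proj₂ q)) ≡
    (dot n q ℤ.* proj₁ p , dot n q ℤ.* proj₁ (proj₂ p) , dot n q ℤ.* proj₂ (proj₂ p))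
  minus-zero rewrite n⊥p = cong₂ _,_ (ℤP.+-identityʳ _)
    (cong₂ _,_ (ℤP.+-identityʳ _) (ℤP.+-identityʳ _))
  n×0 : cross n (cross p q) ≡ 0³
  n×0 = trans (cong (cross n) p∥q) (prove³ (proj₁ n ∷ proj₁ (proj₂ n) ∷ proj₂ (proj₂ n) ∷ [])
    (P.cross (var (Fin.# 0) , var (Fin.# 1) , var (Fin.# 2)) (con 0ℤ , con 0ℤ , con 0ℤ))
      (con 0ℤ , con 0ℤ , con 0ℤ) refl)

-- Two parallel vectors are replaced by one of them. That `u` is literally `p` or `q` lets vanishing
-- determinants pass on to it in `normal₄`.
parallel : ∀ p q → cross p q ≡ 0³ →
  ∃ λ u → (u ≡ p ⊎ u ≡ q) × (∀ n → n ⊥ u → n ⊥ p × n ⊥ q)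
parallel p q p∥q with p ≟³ 0³
... | yes refl = q , inj₂ refl , λ n n⊥q → ⊥0 n , n⊥q
... | no  p≢0  = p , inj₁ refl , λ n n⊥p → n⊥p , parallel⇒⊥ {n} p≢0 p∥q n⊥p

cross⊥ : ∀ p q → cross p q ⊥ p × cross p q ⊥ q
cross⊥ (a , b , c) (d , e , f) =
  solve 6 (λ a b c d e f → P.dot (P.cross (a , b , c) (d , e , f)) (a , b , c) := con 0ℤ)
    refl a b c d e f ,
  solve 6 (λ a b c d e f → P.dot (P.cross (a , b , c) (d , e , f)) (d , e , f) := con 0ℤ)
    refl a b c d e f

det-cyclic : ∀ p q r → dot (cross p q) r ≡ det p q r
det-cyclic (a , b , c) (d , e , f) (g , h , i) =
  solve 9 (λ a b c d e f g h i → P.dot (P.cross (a , b , c) (d , e , f)) (g , h , i)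
    := P.det (a , b , c) (d , e , f) (g , h , i)) refl a b c d e f g h i

normal₁ : ∀ p → ∃ λ n → n ≢ 0³ × n ⊥ p
normal₁ (x , y , z) with x ℤ.≟ 0ℤ
... | yes refl = (+ 1 , 0ℤ , 0ℤ) , (λ ()) ,
  solve 2 (λ y z → P.dot (con (+ 1) , con 0ℤ , con 0ℤ) (con 0ℤ , y , z) := con 0ℤ) refl y z
... | no  x≢0  = (y , ℤ.- x , 0ℤ) ,
  (λ eq → x≢0 (trans (sym (ℤP.neg-involutive x)) (cong (ℤ.-_ ∘ proj₁ ∘ proj₂) eq))) ,
  solve 3 (λ x y z → P.dot (y , :- x , con 0ℤ) (x , y , z) := con 0ℤ) refl x y z

normal₂ : ∀ p q → ∃ λ n → n ≢ 0³ × n ⊥ p × n ⊥ q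
normal₂ p q with cross p q ≟³ 0³
... | no  p∦q = cross p q , p∦q , cross⊥ p q
... | yes p∥q = let u , _ , ⊥u⇒ = parallel p q p∥q
                    n , n≢0 , n⊥u = normal₁ u
                in n , n≢0 , ⊥u⇒ n n⊥u

normal₃ : ∀ p q r → det p q r ≡ 0ℤ → ∃ λ n → n ≢ 0³ × (n ⊥ p × n ⊥ q) × n ⊥ r
normal₃ p q r pqr≡0 with cross p q ≟³ 0³
... | no  p∦q = cross p q , p∦q , cross⊥ p q , trans (det-cyclic p q r) pqr≡0
... | yes p∥q = let u , _ , ⊥u⇒ = parallel p q p∥q
                    n , n≢0 , n⊥u , n⊥r = normal₂ u r
                in n , n≢0 , ⊥u⇒ n n⊥u , n⊥r

-- If `p × q` is nonzero, it is a normal: its products with `r` and `s` are determinants that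
-- vanish. Otherwise one of `p`, `q` stands for both and three vectors remain; `normal₃` and
-- `normal₂` descend in the same way.
normal₄ : ∀ p q r s → det p q r ≡ 0ℤ → det p q s ≡ 0ℤ → det p r s ≡ 0ℤ → det q r s ≡ 0ℤ →
  ∃ λ n → n ≢ 0³ × (n ⊥ p × n ⊥ q) × n ⊥ r × n ⊥ s
normal₄ p q r s pqr pqs prs qrs with cross p q ≟³ 0³
... | no  p∦q = cross p q , p∦q , cross⊥ p q ,
  trans (det-cyclic p q r) pqr , trans (det-cyclic p q s) pqs
... | yes p∥q = let u , u∈ , ⊥u⇒ = parallel p q p∥q
                    n , n≢0 , (n⊥u , n⊥r) , n⊥s = normal₃ u r s (urs≡0 u∈)
                in n , n≢0 , ⊥u⇒ n n⊥u , n⊥r , n⊥s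
  where
  urs≡0 : ∀ {u} → u ≡ p ⊎ u ≡ q → det u r s ≡ 0ℤ
  urs≡0 (inj₁ refl) = prs
  urs≡0 (inj₂ refl) = qrs

det-swap : ∀ p q r → det p r q ≡ ℤ.- det p q r
det-swap (a , b , c) (d , e , f) (g , h , i) =
  solve 9 (λ a b c d e f g h i → P.det (a , b , c) (g , h , i) (d , e , f)
    := :- P.det (a , b , c) (d , e , f) (g , h , i)) refl a b c d e f g h i

degenerate⇒normal : ∀ v → (∀ j → minor v j ≡ 0ℤ) → ∃ λ n → n ≢ 0³ × (∀ i → n ⊥ v i)
degenerate⇒normal v minors≡0 =
  let n , n≢0 , (n⊥v₀ , n⊥v₁) , n⊥v₂ , n⊥v₃ =
        normal₄ (v 0F) (v 1F) (v 2F) (v 3F)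
          (swapped (v 0F) (v 2F) (v 1F) (minors≡0 3F)) (minors≡0 2F)
          (swapped (v 0F) (v 3F) (v 2F) (minors≡0 1F)) (minors≡0 0F)
  in n , n≢0 , λ { 0F → n⊥v₀ ; 1F → n⊥v₁ ; 2F → n⊥v₂ ; 3F → n⊥v₃ }
  where
  swapped : ∀ p q r → det p q r ≡ 0ℤ → det p r q ≡ 0ℤ
  swapped p q r eq = trans (det-swap p q r) (cong ℤ.-_ eq)

-- Lattice points of a plane in a box

Box : ℕ → ℤ³ → Set
Box B (x , y , z) = ∣ x ∣ ≤ B × ∣ y ∣ ≤ B × ∣ z ∣ ≤ B

-- Numbers the interval from -B to B: nonnegative integers keep their value, and -1, ..., -B become
-- B + 1, ..., 2 B.
code : ℕ → ℤ → ℕ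
code B (+ n)    = n
code B -[1+ n ] = suc (B + n)

code< : ∀ {B} i → ∣ i ∣ ≤ B → code B i < suc (B + B)
code< {B} (+ n)    n≤B = s≤s (ℕP.m≤n⇒m≤n+o B n≤B)
code< {B} -[1+ n ] n<B = s≤s (ℕP.+-monoʳ-< B n<B)

code-injective : ∀ {B} i j → ∣ i ∣ ≤ B → ∣ j ∣ ≤ B → code B i ≡ code B j → i ≡ j
code-injective     (+ m)    (+ n)    _   _   eq = cong +_ eq
code-injective {B} (+ m)    -[1+ n ] m≤B _   eq = contradiction (subst (ℕ._≤ B) eq m≤B)
  (ℕP.<⇒≱ (s≤s (ℕP.m≤m+n B n)))
code-injective {B} -[1+ m ] (+ n)    _   n≤B eq = contradiction (subst (ℕ._≤ B) (sym eq) n≤B)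
  (ℕP.<⇒≱ (s≤s (ℕP.m≤m+n B m)))
code-injective {B} -[1+ m ] -[1+ n ] _   _   eq = cong -[1+_]
  (ℕP.+-cancelˡ-≡ B m n (ℕP.suc-injective eq))

encode : ∀ {B} i → ∣ i ∣ ≤ B → Fin (suc (B + B))
encode i i≤B = Fin.fromℕ< (code< i i≤B)

encode-injective : ∀ {B} i j (i≤B : ∣ i ∣ ≤ B) (j≤B : ∣ j ∣ ≤ B) → encode i i≤B ≡ encode j j≤B →
  i ≡ j
encode-injective i j i≤B j≤B eq =
  code-injective i j i≤B j≤B (FinP.fromℕ<-injective _ _ (code< i i≤B) (code< j j≤B) eq)

-- A plane n ⊥ u projects injectively along any axis not contained in it.
plane-projection : ∀ n → n ≢ 0³ → ∃₂ λ (π ρ : ℤ³ → ℤ) →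
  (∀ {B} u → Box B u → ∣ π u ∣ ≤ B × ∣ ρ u ∣ ≤ B) ×
  (∀ u w → n ⊥ u → n ⊥ w → π u ≡ π w → ρ u ≡ ρ w → u ≡ w)
plane-projection (a , b , c) n≢0 with a ℤ.≟ 0ℤ | b ℤ.≟ 0ℤ | c ℤ.≟ 0ℤ
... | no a≢0 | _ | _ = proj₁ ∘ proj₂ , proj₂ ∘ proj₂ , (λ u (_ , y≤ , z≤) → y≤ , z≤) , λ where
  (x , y , z) (x′ , _ , _) n⊥u n⊥w refl refl → cong (_, (y , z))
      (ℤP.*-cancelˡ-≡ a x x′ {{ℤ.≢-nonZero a≢0}}
    (ℤGroup.∙-cancelʳ (b ℤ.* y) _ _ (ℤGroup.∙-cancelʳ (c ℤ.* z) _ _ (trans n⊥u (sym n⊥w)))))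
... | yes _ | no b≢0 | _ = proj₁ , proj₂ ∘ proj₂ , (λ u (x≤ , _ , z≤) → x≤ , z≤) , λ where
  (x , y , z) (_ , y′ , _) n⊥u n⊥w refl refl → cong (λ y → x , y , z)
      (ℤP.*-cancelˡ-≡ b y y′ {{ℤ.≢-nonZero b≢0}}
    (ℤGroup.∙-cancelˡ (a ℤ.* x) _ _ (ℤGroup.∙-cancelʳ (c ℤ.* z) _ _ (trans n⊥u (sym n⊥w)))))
... | yes _ | yes _ | no c≢0 = proj₁ , proj₁ ∘ proj₂ , (λ u (x≤ , y≤ , _) → x≤ , y≤) , λ where
  (x , y , z) (_ , _ , z′) n⊥u n⊥w refl refl → cong (λ z → x , y , z)
      (ℤP.*-cancelˡ-≡ c z z′ {{ℤ.≢-nonZero c≢0}}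
    (ℤGroup.∙-cancelˡ (a ℤ.* x ℤ.+ b ℤ.* y) _ _ (trans n⊥u (sym n⊥w))))
... | yes refl | yes refl | yes refl = contradiction refl n≢0

-- By `plane-projection` a point of the plane is determined by two of its coordinates, and each of
-- these takes at most 2 B + 1 values.
plane-pigeonhole : ∀ {n B N} → n ≢ 0³ → suc (B + B) * suc (B + B) < N →
  (s : Fin N → ℤ³) → (∀ i → n ⊥ s i) → (∀ i → Box B (s i)) →
  ∃₂ λ i j → i Fin.< j × s i ≡ s j
plane-pigeonhole {n} {B} n≢0 N> s n⊥s boxed with plane-projection n n≢0
... | π , ρ , bounded , injective =
  let i , j , i<j , eq = FinP.pigeonhole N> (λ i → Fin.combine (πᶠ i) (ρᶠ i))
  in i , j , i<j , injective (s i) (s j) (n⊥s i) (n⊥s j)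
       (encode-injective (π (s i)) (π (s j)) (π≤ i) (π≤ j)
         (FinP.combine-injectiveˡ (πᶠ i) (ρᶠ i) (πᶠ j) (ρᶠ j) eq))
       (encode-injective (ρ (s i)) (ρ (s j)) (ρ≤ i) (ρ≤ j)
         (FinP.combine-injectiveʳ (πᶠ i) (ρᶠ i) (πᶠ j) (ρᶠ j) eq))
  where
  π≤ : ∀ i → ∣ π (s i) ∣ ≤ B
  π≤ i = proj₁ (bounded (s i) (boxed i))
  ρ≤ : ∀ i → ∣ ρ (s i) ∣ ≤ B
  ρ≤ i = proj₂ (bounded (s i) (boxed i))
  πᶠ ρᶠ : Fin _ → Fin (suc (B + B))
  πᶠ i = encode (π (s i)) (π≤ i)
  ρᶠ i = encode (ρ (s i)) (ρ≤ i)

-- Rounded multiples of a relation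

pairing : (Fin 4 → ℤ) → (Fin 4 → ℤ) → ℤ
pairing c w = Σ₄ (λ i → c i ℤ.* w i)

pairing-cong : ∀ {c e : Fin 4 → ℤ} w → (∀ i → c i ≡ e i) → pairing c w ≡ pairing e w
pairing-cong w eq rewrite eq 0F | eq 1F | eq 2F | eq 3F = refl

module Rounding (a : Fin 4 → ℕ) (d : ℕ) .{{_ : ℕ.NonZero d}} where

  rounded : ℕ → Fin 4 → ℕ
  rounded t i = t * a i / d

  remainder : ℕ → Fin 4 → ℕ
  remainder t i = t * a i % d

  division : ∀ t i → t * a i ≡ remainder t i + rounded t i * d
  division t i = m≡m%n+[m/n]*n (t * a i) d

  rounded-mono : ∀ {t t′} → t ≤ t′ → ∀ i → rounded t i ≤ rounded t′ i
  rounded-mono t≤t′ i = /-monoˡ-≤ d (ℕP.*-monoˡ-≤ (a i) t≤t′)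

  rounded≤ : ∀ {t} → t ≤ d → ∀ i → rounded t i ≤ a i
  rounded≤ t≤d i = ℕP.≤-trans (rounded-mono t≤d i)
    (ℕP.≤-reflexive (trans (cong (_/ d) (ℕP.*-comm d (a i))) (m*n/n≡m (a i) d)))

  -- Since t times the pairing of `a` with `w` vanishes, d times the rounded pairing is minus the
  -- pairing of the remainders with `w`; that has four terms of size at most d m.
  pairing-bound : ∀ {m} (w : Fin 4 → ℤ) → (∀ i → ∣ w i ∣ ≤ m) →
    pairing (λ i → + a i) w ≡ 0ℤ → ∀ t → ∣ pairing (λ i → + rounded t i) w ∣ ≤ 4 * m
  pairing-bound {m} w w≤m aw≡0 t = ℕP.*-cancelˡ-≤ d (begin
    d * ∣ X ∣                        ≡⟨ ℤP.abs-* (+ d) X ⟨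
    ∣ + d ℤ.* X ∣                      ≡⟨ cong ∣_∣ dX≡-R ⟩
    ∣ ℤ.- R ∣                          ≡⟨ ℤP.∣-i∣≡∣i∣ R ⟩
    ∣ R ∣                              ≤⟨ ∣Σ₄∣≤ (λ i → + remainder t i ℤ.* w i) ⟩
    Σ₄ℕ (λ i → ∣ + remainder t i ℤ.* w i ∣)
                                       ≤⟨ Σ₄-mono term≤ ⟩
    Σ₄ℕ (λ _ → d * m)                ≡⟨ four d m ⟩
    d * (4 * m)                    ∎)
    where
    open ℕP.≤-Reasoning
    X = pairing (λ i → + rounded t i) w
    R = pairing (λ i → + remainder t i) w
    term≤ : ∀ i → ∣ + remainder t i ℤ.* w i ∣ ≤ d * m
    term≤ i = ℕP.≤-trans (ℕP.≤-reflexive (ℤP.abs-* (+ remainder t i) (w i)))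
      (ℕP.*-mono-≤ (ℕP.<⇒≤ (m%n<n (t * a i) d)) (w≤m i))
    ∣Σ₄∣≤ : ∀ f → ∣ Σ₄ f ∣ ≤ Σ₄ℕ (λ i → ∣ f i ∣)
    ∣Σ₄∣≤ f = ℕP.≤-trans (ℤP.∣i+j∣≤∣i∣+∣j∣ (f 0F ℤ.+ f 1F ℤ.+ f 2F) (f 3F)) (ℕP.+-monoˡ-≤ ∣ f 3F ∣
      (ℕP.≤-trans (ℤP.∣i+j∣≤∣i∣+∣j∣ (f 0F ℤ.+ f 1F) (f 2F))
        (ℕP.+-monoˡ-≤ ∣ f 2F ∣ (ℤP.∣i+j∣≤∣i∣+∣j∣ (f 0F) (f 1F)))))
    four : ∀ d m → Σ₄ℕ (λ _ → d * m) ≡ d * (4 * m)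
    four d m = solveℕ 2 (λ d m → ((d ⊗ m ⊕ d ⊗ m) ⊕ d ⊗ m) ⊕ d ⊗ m
      ⊜ d ⊗ (conℕ 4 ⊗ m)) refl d m
    divisionℤ : ∀ i → + t ℤ.* + a i ≡ + remainder t i ℤ.+ + rounded t i ℤ.* + d
    divisionℤ i = trans (sym (ℤP.pos-* t (a i))) (trans (cong +_ (division t i))
      (cong (λ k → + remainder t i ℤ.+ k) (ℤP.pos-* (rounded t i) d)))
    identity : ∀ t d (a r x : Fin 4 → ℤ) → (∀ i → t ℤ.* a i ≡ r i ℤ.+ x i ℤ.* d) →
      t ℤ.* pairing a w ≡ pairing r w ℤ.+ d ℤ.* pairing x w
    identity t d a r x eq = trans
      (solve 9 (λ t a b c e x y z w → t :* (a :* x :+ b :* y :+ c :* z :+ e :* w)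
        := t :* a :* x :+ t :* b :* y :+ t :* c :* z :+ t :* e :* w)
          refl t (a 0F) (a 1F) (a 2F) (a 3F) (w 0F) (w 1F) (w 2F) (w 3F))
      (trans (cong₂ ℤ._+_ (cong₂ ℤ._+_ (cong₂ ℤ._+_ (cong (ℤ._* w 0F) (eq 0F))
        (cong (ℤ._* w 1F) (eq 1F))) (cong (ℤ._* w 2F) (eq 2F))) (cong (ℤ._* w 3F) (eq 3F)))
      (solve 13 (λ d r₀ r₁ r₂ r₃ x₀ x₁ x₂ x₃ w₀ w₁ w₂ w₃ →
        (r₀ :+ x₀ :* d) :* w₀ :+ (r₁ :+ x₁ :* d) :* w₁ :+ (r₂ :+ x₂ :* d) :* w₂ :+
          (r₃ :+ x₃ :* d) :* w₃
        := (r₀ :* w₀ :+ r₁ :* w₁ :+ r₂ :* w₂ :+ r₃ :* w₃) :+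
          d :* (x₀ :* w₀ :+ x₁ :* w₁ :+ x₂ :* w₂ :+ x₃ :* w₃))
        refl d (r 0F) (r 1F) (r 2F) (r 3F) (x 0F) (x 1F) (x 2F) (x 3F) (w 0F) (w 1F) (w 2F) (w 3F)))
    dX≡-R : + d ℤ.* X ≡ ℤ.- R
    dX≡-R = ℤGroup.inverseʳ-unique R (+ d ℤ.* X) (trans
      (sym (identity (+ t) (+ d) (λ i → + a i) (λ i → + remainder t i) (λ i → + rounded t i)
        divisionℤ))
      (trans (cong (+ t ℤ.*_) aw≡0) (ℤP.*-zeroʳ (+ t))))

  module _ (Σa≡d : Σ₄ℕ a ≡ d) where

    Σ-division : ∀ t → t * d ≡ Σ₄ℕ (remainder t) + Σ₄ℕ (rounded t) * d
    Σ-division t = trans (cong (t ℕ.*_) (sym Σa≡d)) (trans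
      (solveℕ 5 (λ t a b c e → t ⊗ (a ⊕ b ⊕ c ⊕ e)
        ⊜ t ⊗ a ⊕ t ⊗ b ⊕ t ⊗ c ⊕ t ⊗ e) refl t (a 0F) (a 1F) (a 2F) (a 3F))
      (trans (Σ₄-cong {λ i → t * a i} (division t))
      (solveℕ 9 (λ d r₀ r₁ r₂ r₃ x₀ x₁ x₂ x₃ →
        (r₀ ⊕ x₀ ⊗ d) ⊕ (r₁ ⊕ x₁ ⊗ d) ⊕ (r₂ ⊕ x₂ ⊗ d) ⊕ (r₃ ⊕ x₃ ⊗ d)
        ⊜ (r₀ ⊕ r₁ ⊕ r₂ ⊕ r₃) ⊕ (x₀ ⊕ x₁ ⊕ x₂ ⊕ x₃) ⊗ d) refl
        d (remainder t 0F) (remainder t 1F) (remainder t 2F) (remainder t 3F) (rounded t 0F)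
          (rounded t 1F) (rounded t 2F) (rounded t 3F))))

    Σ-rounded≤ : ∀ t → Σ₄ℕ (rounded t) ≤ t
    Σ-rounded≤ t = ℕP.*-cancelʳ-≤ (Σ₄ℕ (rounded t)) t d
      (ℕP.≤-trans (ℕP.m≤n+m (Σ₄ℕ (rounded t) * d) (Σ₄ℕ (remainder t)))
      (ℕP.≤-reflexive (sym (Σ-division t))))

    -- Each of the four roundings loses less than 1, because every remainder is below `d`.
    t<Σ-rounded+4 : ∀ t → t < 4 + Σ₄ℕ (rounded t)
    t<Σ-rounded+4 t = ℕP.*-cancelʳ-< d t (4 + Σ₄ℕ (rounded t)) (begin-strict
      t * d                                               ≡⟨ Σ-division t ⟩
      Σ₄ℕ (remainder t) + Σ₄ℕ (rounded t) * d
        <⟨ ℕP.+-monoˡ-< (Σ₄ℕ (rounded t) * d) Σr<4d ⟩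
      4 * d + Σ₄ℕ (rounded t) * d                     ≡⟨ ℕP.*-distribʳ-+ d 4 (Σ₄ℕ (rounded t)) ⟨
      (4 + Σ₄ℕ (rounded t)) * d                         ∎)
      where
      open ℕP.≤-Reasoning
      r< : ∀ i → remainder t i < d
      r< i = m%n<n (t * a i) d
      Σr<4d : Σ₄ℕ (remainder t) < 4 * d
      Σr<4d = ℕP.<-≤-trans (ℕP.+-mono-< (ℕP.+-mono-< (ℕP.+-mono-< (r< 0F) (r< 1F)) (r< 2F)) (r< 3F))
        (ℕP.≤-reflexive (solveℕ 1 (λ d → d ⊕ d ⊕ d ⊕ d ⊜ conℕ 4 ⊗ d) refl d))

Box-combination : ∀ {m} a {d} .{{_ : ℕ.NonZero d}} v → (∀ i → Box m (v i)) → Relation a v →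
  ∀ t → Box (4 * m) (combination (λ i → + Rounding.rounded a d t i) v)
Box-combination a {d} v boxed rel t =
  pairing-bound (proj₁ ∘ v) (proj₁ ∘ boxed) (cong proj₁ rel) t ,
  pairing-bound (proj₁ ∘ proj₂ ∘ v) (proj₁ ∘ proj₂ ∘ boxed) (cong (proj₁ ∘ proj₂) rel) t ,
  pairing-bound (proj₂ ∘ proj₂ ∘ v) (proj₂ ∘ proj₂ ∘ boxed) (cong (proj₂ ∘ proj₂) rel) t
  where open Rounding a d

⊥-combination : ∀ {n v} c → (∀ i → n ⊥ v i) → n ⊥ combination c v
⊥-combination {n@(x , y , z)} {v} c n⊥v = trans
  (solve 19 (λ x y z c₀ c₁ c₂ c₃ x₀ y₀ z₀ x₁ y₁ z₁ x₂ y₂ z₂ x₃ y₃ z₃ →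
     let n = x , y , z in
     P.dot n (c₀ :* x₀ :+ c₁ :* x₁ :+ c₂ :* x₂ :+ c₃ :* x₃ ,
              c₀ :* y₀ :+ c₁ :* y₁ :+ c₂ :* y₂ :+ c₃ :* y₃ ,
              c₀ :* z₀ :+ c₁ :* z₁ :+ c₂ :* z₂ :+ c₃ :* z₃)
     := c₀ :* P.dot n (x₀ , y₀ , z₀) :+ c₁ :* P.dot n (x₁ , y₁ , z₁)
     :+ c₂ :* P.dot n (x₂ , y₂ , z₂) :+ c₃ :* P.dot n (x₃ , y₃ , z₃)) refl
     x y z (c 0F) (c 1F) (c 2F) (c 3F)
     (proj₁ (v 0F)) (proj₁ (proj₂ (v 0F))) (proj₂ (proj₂ (v 0F)))
     (proj₁ (v 1F)) (proj₁ (proj₂ (v 1F))) (proj₂ (proj₂ (v 1F)))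
     (proj₁ (v 2F)) (proj₁ (proj₂ (v 2F))) (proj₂ (proj₂ (v 2F)))
     (proj₁ (v 3F)) (proj₁ (proj₂ (v 3F))) (proj₂ (proj₂ (v 3F))))
  (cong₂ ℤ._+_ (cong₂ ℤ._+_ (cong₂ ℤ._+_ (zero* 0F) (zero* 1F)) (zero* 2F)) (zero* 3F))
  where
  zero* : ∀ i → c i ℤ.* dot n (v i) ≡ 0ℤ
  zero* i = trans (cong (c i ℤ.*_) (n⊥v i)) (ℤP.*-zeroʳ (c i))

combination-∸ : ∀ (a b : Fin 4 → ℕ) (v : Fin 4 → ℤ³) → (∀ i → a i ≤ b i) →
  combination (λ i → + a i) v ≡ combination (λ i → + b i) v → Relation (λ i → b i ∸ a i) v
combination-∸ a b v a≤b eq = cong₂ _,_ (component (proj₁ ∘ v) (cong proj₁ eq))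
  (cong₂ _,_ (component (proj₁ ∘ proj₂ ∘ v) (cong (proj₁ ∘ proj₂) eq))
             (component (proj₂ ∘ proj₂ ∘ v) (cong (proj₂ ∘ proj₂) eq)))
  where
  +∸ : ∀ i → + (b i ∸ a i) ≡ + b i ℤ.- + a i
  +∸ i = trans (sym (ℤP.⊖-≥ (a≤b i))) (sym (ℤP.m-n≡m⊖n (b i) (a i)))
  component : ∀ w → pairing (λ i → + a i) w ≡ pairing (λ i → + b i) w →
              pairing (λ i → + (b i ∸ a i)) w ≡ 0ℤ
  component w eq = trans (pairing-cong {λ i → + (b i ∸ a i)} {λ i → + b i ℤ.- + a i} w +∸) $ trans
    (solve 12 (λ a b c d a′ b′ c′ d′ x y z w →
      (a :- a′) :* x :+ (b :- b′) :* y :+ (c :- c′) :* z :+ (d :- d′) :* w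
      := (a :* x :+ b :* y :+ c :* z :+ d :* w) :- (a′ :* x :+ b′ :* y :+ c′ :* z :+ d′ :* w)) refl
      (+ b 0F) (+ b 1F) (+ b 2F) (+ b 3F) (+ a 0F) (+ a 1F) (+ a 2F) (+ a 3F)
      (w 0F) (w 1F) (w 2F) (w 3F))
    (ℤP.i≡j⇒i-j≡0 {pairing (λ i → + b i) w} {pairing (λ i → + a i) w} (sym eq))

Σ₄-∸ : ∀ (a b : Fin 4 → ℕ) → (∀ i → a i ≤ b i) → Σ₄ℕ (λ i → b i ∸ a i) + Σ₄ℕ a ≡ Σ₄ℕ b
Σ₄-∸ a b a≤b = trans
  (solveℕ 8 (λ a b c d x y z w → (a ⊕ b ⊕ c ⊕ d) ⊕ (x ⊕ y ⊕ z ⊕ w)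
    ⊜ (a ⊕ x) ⊕ (b ⊕ y) ⊕ (c ⊕ z) ⊕ (d ⊕ w)) refl
    (b 0F ∸ a 0F) (b 1F ∸ a 1F) (b 2F ∸ a 2F) (b 3F ∸ a 3F) (a 0F) (a 1F) (a 2F) (a 3F))
  (Σ₄-cong {λ i → b i ∸ a i + a i} (λ i → ℕP.m∸n+n≡m (a≤b i)))

module _ {a v} (minimal : MinimalRelation a v) where

  private
    d = Σ₄ℕ a
    instance d≢0 : ℕ.NonZero d
             d≢0 = ℕ.>-nonZero (proj₁ minimal)

  open Rounding a d

  rounded-sum : ℕ → ℤ³
  rounded-sum t = combination (λ i → + rounded t i) v

  -- Equal sums would make the difference `b` of the two families a relation below `a`. It is
  -- nonzero because a gap of 4 exceeds the rounding loss, and it is shorter than `a` because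
  -- `t < d`, contrary to minimality.
  rounded-sums-distinct : ∀ {s t} → 4 + s ≤ t → t < d → rounded-sum s ≢ rounded-sum t
  rounded-sums-distinct {s} {t} 4+s≤t t<d eq = ℕP.<⇒≢ Σb<d (proj₂ (proj₂ minimal) b b≤a
    (combination-∸ (rounded s) (rounded t) v (rounded-mono s≤t) eq) 0<Σb)
    where
    s≤t : s ≤ t
    s≤t = ℕP.m+n≤o⇒n≤o 4 4+s≤t
    b : Fin 4 → ℕ
    b i = rounded t i ∸ rounded s i
    Σb+ : Σ₄ℕ b + Σ₄ℕ (rounded s) ≡ Σ₄ℕ (rounded t)
    Σb+ = Σ₄-∸ (rounded s) (rounded t) (rounded-mono s≤t)
    b≤a : ∀ i → b i ≤ a i
    b≤a i = ℕP.≤-trans (ℕP.m∸n≤m (rounded t i) (rounded s i)) (rounded≤ (ℕP.<⇒≤ t<d) i)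
    Σb<d : Σ₄ℕ b < d
    Σb<d = ℕP.≤-<-trans (ℕP.≤-trans (ℕP.m≤m+n (Σ₄ℕ b) (Σ₄ℕ (rounded s)))
      (ℕP.≤-trans (ℕP.≤-reflexive Σb+) (Σ-rounded≤ refl t))) t<d
    Σs<Σt : Σ₄ℕ (rounded s) < Σ₄ℕ (rounded t)
    Σs<Σt = ℕP.+-cancelˡ-< 4 (Σ₄ℕ (rounded s)) (Σ₄ℕ (rounded t))
      (ℕP.≤-<-trans (ℕP.+-monoʳ-≤ 4 (Σ-rounded≤ refl s))
      (ℕP.≤-<-trans 4+s≤t (t<Σ-rounded+4 refl t)))
    0<Σb : 0 < Σ₄ℕ b
    0<Σb = ℕP.n≢0⇒n>0 λ Σb≡0 → ℕP.<⇒≢ Σs<Σt (subst (λ k → k + Σ₄ℕ (rounded s) ≡ Σ₄ℕ (rounded t))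
      Σb≡0 Σb+)

  degenerate-bound : ∀ {n m} → (∀ i → Box m (v i)) → n ≢ 0³ → (∀ i → n ⊥ v i) →
    d ≤ suc (4 * m + 4 * m) * suc (4 * m + 4 * m) * 4
  degenerate-bound {n} {m} boxed n≢0 n⊥v = ℕP.≮⇒≥ λ 4N<d →
    -- The N + 1 indices t = 4 k with k ≤ N are one more than the plane has room for, and `4N<d`
    -- keeps all of them below `d`.
    let j , k , j<k , eq = plane-pigeonhole {n} {4 * m} n≢0 (ℕP.n<1+n N)
          (λ k → rounded-sum (toℕ k * 4))
          (λ k → ⊥-combination {n} {v} (λ i → + rounded (toℕ k * 4) i) n⊥v)
          (λ k → Box-combination a v boxed (proj₁ (proj₂ minimal)) (toℕ k * 4))
    -- Multiplied by 4, `j<k` is by computation the required gap of 4.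
    in rounded-sums-distinct (ℕP.*-monoˡ-≤ 4 j<k)
         (ℕP.≤-<-trans (ℕP.*-monoˡ-≤ 4 (FinP.toℕ≤pred[n] k)) 4N<d) eq
    where
    N : ℕ
    N = suc (4 * m + 4 * m) * suc (4 * m + 4 * m)

-- The upper bound for sequences in the ball

square-abs : ∀ i → i ℤ.* i ≡ + (∣ i ∣ * ∣ i ∣)
square-abs (+ n)    = sym (ℤP.pos-* n n)
square-abs -[1+ n ] = refl

square-cancel-≤ : ∀ {m n} → m * m ≤ n * n → m ≤ n
square-cancel-≤ m²≤n² = ℕP.≮⇒≥ λ n<m → ℕP.<⇒≱ (ℕP.*-mono-< n<m n<m) m²≤n²

InBall⇒Box : ∀ {m} u → InBall m u → Box m u
InBall⇒Box {m} (x , y , z) inBall =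
  square-cancel-≤ (ℕP.m+n≤o⇒m≤o _ (ℕP.m+n≤o⇒m≤o _ norm≤)) ,
  square-cancel-≤ (ℕP.m+n≤o⇒n≤o (∣ x ∣ * ∣ x ∣) (ℕP.m+n≤o⇒m≤o _ norm≤)) ,
  square-cancel-≤ (ℕP.m+n≤o⇒n≤o (∣ x ∣ * ∣ x ∣ + ∣ y ∣ * ∣ y ∣) norm≤)
  where
  norm≤ : ∣ x ∣ * ∣ x ∣ + ∣ y ∣ * ∣ y ∣ + ∣ z ∣ * ∣ z ∣ ≤ m * m
  norm≤ = ℤP.drop‿+≤+ (subst (ℤ._≤ + (m * m))
    (cong₂ ℤ._+_ (cong₂ ℤ._+_ (square-abs x) (square-abs y)) (square-abs z)) inBall)

-- d ≤ (16 / (3√3)) m³, squared.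
LengthBound : ℕ → ℕ → Set
LengthBound m d = 27 * (d * d) ≤ 256 * (m * m * (m * m) * (m * m))

-- In the degenerate case 324 = 4 · 9² bounds 4 (8m + 1)² / m², and 106 is the least
-- m with 27 · 324² ≤ 256 m².
MinimalRelation-bound : ∀ {a v m} → 106 ≤ m → MinimalRelation a v → (∀ i → InBall m (v i)) →
  LengthBound m (Σ₄ℕ a)
MinimalRelation-bound {a} {v} {m} 106≤m minimal inBall with FinP.all? (λ j → minor v j ℤ.≟ 0ℤ)
... | no nonzero =
  let j , mⱼ≢0 = FinP.¬∀⟶∃¬ 4 _ (λ j → minor v j ℤ.≟ 0ℤ) nonzero
      Σa≤ = nondegenerate-bound {a} {v} minimal j mⱼ≢0 in
  ℕP.≤-trans (ℕP.*-monoʳ-≤ 27 (ℕP.*-mono-≤ Σa≤ Σa≤)) (ℤP.drop‿+≤+ (subst₂ ℤ._≤_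
    (trans (cong (+ 27 ℤ.*_) (square-abs Δ)) (sym (ℤP.pos-* 27 (∣ Δ ∣ * ∣ Δ ∣))))
    (trans (cong (+ 256 ℤ.*_) (trans (cong (ℤ._* + M) (sym (ℤP.pos-* M M)))
      (sym (ℤP.pos-* (M * M) M)))) (sym (ℤP.pos-* 256 (M * M * M))))
    (Σ₄-minors-bound v inBall)))
  where
  Δ = Σ₄ (minor v)
  M = m * m
... | yes zeros =
  let n , n≢0 , n⊥v = degenerate⇒normal v zeros
      Σa≤ = ℕP.≤-trans (degenerate-bound {a} {v} minimal {n} {m}
        (λ i → InBall⇒Box (v i) (inBall i)) n≢0 n⊥v) quadratic in
  begin
    27 * (Σ₄ℕ a * Σ₄ℕ a)               ≤⟨ ℕP.*-monoʳ-≤ 27 (ℕP.*-mono-≤ Σa≤ Σa≤) ⟩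
    27 * (324 * M * (324 * M))
      ≡⟨ solveℕ 1 (λ M → conℕ 27 ⊗ (conℕ 324 ⊗ M ⊗ (conℕ 324 ⊗ M))
        ⊜ M ⊗ M ⊗ conℕ (27 * (324 * 324))) refl M ⟩
    M * M * (27 * (324 * 324))
      ≤⟨ ℕP.*-monoʳ-≤ (M * M) (ℕP.≤ᵇ⇒≤ (27 * (324 * 324)) (256 * (106 * 106)) _) ⟩
    M * M * (256 * (106 * 106))
      ≤⟨ ℕP.*-monoʳ-≤ (M * M) (ℕP.*-monoʳ-≤ 256 (ℕP.*-mono-≤ 106≤m 106≤m)) ⟩
    M * M * (256 * M)
      ≡⟨ solveℕ 1 (λ M → M ⊗ M ⊗ (conℕ 256 ⊗ M) ⊜ conℕ 256 ⊗ (M ⊗ M ⊗ M)) refl M ⟩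
    256 * (M * M * M)                ∎
  where
  open ℕP.≤-Reasoning
  M = m * m
  8m+1≤9m : suc (4 * m + 4 * m) ≤ 9 * m
  8m+1≤9m = ℕP.≤-trans (ℕP.+-monoˡ-≤ (4 * m + 4 * m) (ℕP.≤-trans (s≤s z≤n) 106≤m))
    (ℕP.≤-reflexive (solveℕ 1 (λ m → m ⊕ (conℕ 4 ⊗ m ⊕ conℕ 4 ⊗ m) ⊜ conℕ 9 ⊗ m) refl m))
  quadratic : suc (4 * m + 4 * m) * suc (4 * m + 4 * m) * 4 ≤ 324 * M
  quadratic = ℕP.≤-trans (ℕP.*-monoˡ-≤ 4 (ℕP.*-mono-≤ 8m+1≤9m 8m+1≤9m))
    (ℕP.≤-reflexive (solveℕ 1 (λ m → conℕ 9 ⊗ m ⊗ (conℕ 9 ⊗ m) ⊗ conℕ 4 ⊜ conℕ 324 ⊗ (m ⊗ m))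
      refl m))

-- With the support as `vs`, this turns an admissible sequence into an index list, whose counts form
-- a relation between the four support vectors.
labelling : ∀ {A : Set} (vs S : List A) → All (_∈ vs) S → ∃ λ L → S ≡ map (lookup vs) L
labelling vs []      []           = [] , refl
labelling vs (x ∷ S) (x∈vs ∷ S⊆) =
  let L , eq = labelling vs S S⊆
  in Any.index x∈vs ∷ L , cong₂ _∷_ (AnyP.lookup-index x∈vs) eq

Admissible⇒bound : ∀ {m} S → 106 ≤ m → Admissible 4 m S → LengthBound m (length S)
Admissible⇒bound {m} S 106≤m (inBall , minimal , |support|≡4) =
  bound (support S) |support|≡4 (All.tabulate (∈-deduplicate⁺ _≟³_))
    (All.tabulate λ u∈ → All.lookup inBall (∈-deduplicate⁻ _≟³_ S u∈))
  where
  bound : ∀ vs → length vs ≡ 4 → All (_∈ vs) S → All (InBall m) vs → LengthBound m (length S)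
  bound vs@(_ ∷ _ ∷ _ ∷ _ ∷ []) refl S⊆vs vs⊆ball with labelling vs S S⊆vs
  ... | L , refl = subst (LengthBound m) (trans (Σ₄-count L) (sym (ListP.length-map (lookup vs) L)))
    (MinimalRelation-bound {count L} {lookup vs} 106≤m
      (minimal⇒MinimalRelation (lookup vs) L minimal)
      (λ i → All.lookup vs⊆ball (∈-lookup i)))

-- The extremal family

-- The cubic 4 n³ + e n² + d n + c; the leading coefficient is common to all four minors of the
-- extremal family.
horner : ℕ → ℕ → ℕ → ℕ → ℕ
horner c d e n = c + n * (d + n * (e + n * 4))

+-horner : ∀ c d e n → + horner c d e n ≡ + c ℤ.+ + n ℤ.* (+ d ℤ.+ + n ℤ.* (+ e ℤ.+ + n ℤ.* + 4))
+-horner c d e n = cong (λ k → + c ℤ.+ k) (trans (ℤP.pos-* n _) (cong (λ k → + n ℤ.* (+ d ℤ.+ k))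
  (trans (ℤP.pos-* n _) (cong (λ k → + n ℤ.* (+ e ℤ.+ k)) (ℤP.pos-* n 4)))))

-- The perturbation makes the first and last minors differ by exactly 1.
tetrahedron : ℕ → Fin 4 → ℤ³
tetrahedron n 0F = + n , + n , + suc n
tetrahedron n 1F = ℤ.- + n , + n , ℤ.- + suc n
tetrahedron n 2F = + suc n , ℤ.- + n , ℤ.- + n
tetrahedron n 3F = ℤ.- + n , ℤ.- + suc n , + suc n

-- The minors of `tetrahedron n` as natural numbers. The constant term comes first, so that the
-- first weight is by computation the successor of the last.
weight : ℕ → Fin 4 → ℕ
weight n 0F = horner 1 2 4 n
weight n 1F = horner 1 4 8 n
weight n 2F = horner 0 0 4 n
weight n 3F = horner 0 2 4 n

minor-tetrahedron : ∀ n i → minor (tetrahedron n) i ≡ + weight n i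
minor-tetrahedron n i = trans (expand i) (sym (cast i))
  where
  x sx : Polynomial 1
  x = var 0F
  sx = con (+ 1) :+ x
  v : Fin 4 → Polynomial 1 × Polynomial 1 × Polynomial 1
  v 0F = x , x , sx
  v 1F = :- x , x , :- sx
  v 2F = sx , :- x , :- x
  v 3F = :- x , :- sx , sx
  poly : ℕ → ℕ → ℕ → Polynomial 1
  poly c d e = con (+ c) :+ x :* (con (+ d) :+ x :* (con (+ e) :+ x :* con (+ 4)))
  hornerᶻ : ℕ → ℕ → ℕ → ℤ
  hornerᶻ c d e = + c ℤ.+ + n ℤ.* (+ d ℤ.+ + n ℤ.* (+ e ℤ.+ + n ℤ.* + 4))
  weightᶻ : Fin 4 → ℤ
  weightᶻ 0F = hornerᶻ 1 2 4
  weightᶻ 1F = hornerᶻ 1 4 8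
  weightᶻ 2F = hornerᶻ 0 0 4
  weightᶻ 3F = hornerᶻ 0 2 4
  cast : ∀ i → + weight n i ≡ weightᶻ i
  cast 0F = +-horner 1 2 4 n
  cast 1F = +-horner 1 4 8 n
  cast 2F = +-horner 0 0 4 n
  cast 3F = +-horner 0 2 4 n
  expand : ∀ i → minor (tetrahedron n) i ≡ weightᶻ i
  expand 0F = prove (+ n ∷ []) (P.minor v 0F) (poly 1 2 4) refl
  expand 1F = prove (+ n ∷ []) (P.minor v 1F) (poly 1 4 8) refl
  expand 2F = prove (+ n ∷ []) (P.minor v 2F) (poly 0 0 4) refl
  expand 3F = prove (+ n ∷ []) (P.minor v 3F) (poly 0 2 4) refl

-- In fact b = (b 0F − b 3F) a; the proof is this identity without subtraction.
∝-consecutive⇒zero∨≥ : ∀ (a b : Fin 4 → ℕ) → a 0F ≡ suc (a 3F) →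
  (∀ i j → b i * a j ≡ b j * a i) → (∀ i → b i ≡ 0) ⊎ (∀ i → a i ≤ b i)
∝-consecutive⇒zero∨≥ a b a₀≡1+a₃ b∝a = cases (ℕP.<-≤-connex (b 3F) (b 0F))
  where
  multiple : ∀ i → b i + b 3F * a i ≡ b 0F * a i
  multiple i = begin
    b i + b 3F * a i    ≡⟨ cong (b i ℕ.+_) (b∝a 3F i) ⟩
    b i + b i * a 3F    ≡⟨ ℕP.*-suc (b i) (a 3F) ⟨
    b i * suc (a 3F)    ≡⟨ cong (b i ℕ.*_) a₀≡1+a₃ ⟨
    b i * a 0F          ≡⟨ b∝a i 0F ⟩
    b 0F * a i          ∎
    where open ≡-Reasoning
  cases : b 3F < b 0F ⊎ b 0F ≤ b 3F → (∀ i → b i ≡ 0) ⊎ (∀ i → a i ≤ b i)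
  cases (inj₁ b₃<b₀) = inj₂ λ i → ℕP.+-cancelʳ-≤ (b 3F * a i) (a i) (b i)
    (ℕP.≤-trans (ℕP.*-monoˡ-≤ (a i) b₃<b₀) (ℕP.≤-reflexive (sym (multiple i))))
  cases (inj₂ b₀≤b₃) = inj₁ λ i → ℕP.n≤0⇒n≡0 (ℕP.+-cancelʳ-≤ (b 3F * a i) (b i) 0
    (ℕP.≤-trans (ℕP.≤-reflexive (multiple i)) (ℕP.*-monoˡ-≤ (a i) b₀≤b₃)))

-- Every relation is proportional to the minors, hence to the weights. As two weights are
-- consecutive, a subrelation is either zero or at least the whole.
weight-minimal : ∀ n → MinimalRelation (weight n) (tetrahedron n)
weight-minimal n = ℕP.<-≤-trans ℕ.z<s (≤Σ₄ (weight n) 0F) , relation , minimal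
  where
  v = tetrahedron n
  relation : Relation (weight n) v
  relation = trans (combination-cong v (sym ∘ minor-tetrahedron n)) (minors-relation v)
  minimal : ∀ b → (∀ i → b i ≤ weight n i) → Relation b v → 0 < Σ₄ℕ b → Σ₄ℕ b ≡ Σ₄ℕ (weight n)
  minimal b b≤ rel 0<Σb with ∝-consecutive⇒zero∨≥ (weight n) b refl b∝weight
    where
    b∝weight : ∀ i j → b i * weight n j ≡ b j * weight n i
    b∝weight i j = ℤP.+-injective (begin
      + (b i * weight n j)    ≡⟨ ℤP.pos-* (b i) _ ⟩
      + b i ℤ.* + weight n j    ≡⟨ cong (+ b i ℤ.*_) (minor-tetrahedron n j) ⟨
      + b i ℤ.* minor v j       ≡⟨ relation-∝-minors {λ k → + b k} {v} rel i j ⟩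
      + b j ℤ.* minor v i       ≡⟨ cong (+ b j ℤ.*_) (minor-tetrahedron n i) ⟩
      + b j ℤ.* + weight n i    ≡⟨ ℤP.pos-* (b j) _ ⟨
      + (b j * weight n i)    ∎)
      where open ≡-Reasoning
  ... | inj₁ b≡0 = contradiction (sym (Σ₄-zero b≡0)) (ℕP.<⇒≢ 0<Σb)
  ... | inj₂ b≥  = Σ₄-cong λ i → ℕP.≤-antisym (b≤ i) (b≥ i)

-- A sequence with the given weights

count-++ : ∀ K L i → count (K ++ L) i ≡ count K i + count L i
count-++ []      L i = refl
count-++ (j ∷ K) L i = trans (cong (δ j i ℕ.+_) (count-++ K L i)) (sym (ℕP.+-assoc (δ j i) _ _))

count-replicate : ∀ k j i → count (replicate k j) i ≡ k * δ j i
count-replicate zero    j i = refl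
count-replicate (suc k) j i = cong (δ j i ℕ.+_) (count-replicate k j i)

withCounts : ∀ (a : Fin 4 → ℕ) → ∃ λ L → ∀ i → count L i ≡ a i
withCounts a = L , λ i → trans (counts i) (select-i i)
  where
  block : Fin 4 → List (Fin 4)
  block j = replicate (a j) j
  L = block 0F ++ block 1F ++ block 2F ++ block 3F
  counts : ∀ i → count L i ≡ a 0F * δ 0F i + (a 1F * δ 1F i + (a 2F * δ 2F i + a 3F * δ 3F i))
  counts i = trans (count-++ (block 0F) _ i) (cong₂ _+_ (count-replicate (a 0F) 0F i)
    (trans (count-++ (block 1F) _ i) (cong₂ _+_ (count-replicate (a 1F) 1F i)
    (trans (count-++ (block 2F) _ i) (cong₂ _+_ (count-replicate (a 2F) 2F i)
      (count-replicate (a 3F) 3F i))))))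
  select-i : ∀ i → a 0F * δ 0F i + (a 1F * δ 1F i + (a 2F * δ 2F i + a 3F * δ 3F i)) ≡ a i
  select-i 0F = solveℕ 4 (λ a b c d → a ⊗ conℕ 1 ⊕ (b ⊗ conℕ 0 ⊕ (c ⊗ conℕ 0 ⊕ d ⊗ conℕ 0)) ⊜ a)
    refl (a 0F) (a 1F) (a 2F) (a 3F)
  select-i 1F = solveℕ 4 (λ a b c d → a ⊗ conℕ 0 ⊕ (b ⊗ conℕ 1 ⊕ (c ⊗ conℕ 0 ⊕ d ⊗ conℕ 0)) ⊜ b)
    refl (a 0F) (a 1F) (a 2F) (a 3F)
  select-i 2F = solveℕ 4 (λ a b c d → a ⊗ conℕ 0 ⊕ (b ⊗ conℕ 0 ⊕ (c ⊗ conℕ 1 ⊕ d ⊗ conℕ 0)) ⊜ c)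
    refl (a 0F) (a 1F) (a 2F) (a 3F)
  select-i 3F = solveℕ 4 (λ a b c d → a ⊗ conℕ 0 ⊕ (b ⊗ conℕ 0 ⊕ (c ⊗ conℕ 0 ⊕ d ⊗ conℕ 1)) ⊜ d)
    refl (a 0F) (a 1F) (a 2F) (a 3F)

0<count⇒∈ : ∀ {i} L → 0 < count L i → i ∈ L
0<count⇒∈ {i} (j ∷ L) 0<count with j Fin.≟ i
... | yes refl = here refl
... | no  _    = there (0<count⇒∈ L 0<count)

MinimalRelation-resp : ∀ {a b v} → (∀ i → a i ≡ b i) → MinimalRelation a v → MinimalRelation b v
MinimalRelation-resp {a} {b} {v} a≡b (0<Σa , rel , minimal) =
  subst (0 ℕ.<_) Σa≡Σb 0<Σa , Relation-resp {a} {b} {v} a≡b rel ,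
  λ c c≤b relc 0<Σc → trans (minimal c (λ i → ℕP.≤-trans (c≤b i) (ℕP.≤-reflexive (sym (a≡b i))))
    relc 0<Σc) Σa≡Σb
  where Σa≡Σb = Σ₄-cong {a} {b} a≡b

-- The support and the list of the four values are both free of repetitions and have the same
-- elements, so they are permutations of each other.
length-support : ∀ v L → Unique (map v (List.allFin 4)) →
  (∀ i → i ∈ L) → length (support (map v L)) ≡ 4
length-support v L unique every = ↭-length (∼bag⇒↭ (unique∧set⇒bag (deduplicate-! (map v L)) unique
  (mk⇔ (λ x∈ → let i , _ , x≡vi = ∈-map⁻ v (∈-deduplicate⁻ _≟³_ (map v L) x∈)
                in subst (_∈ map v (List.allFin 4)) (sym x≡vi) (∈-map⁺ v (∈-allFin i)))
       (λ x∈ → let i , _ , x≡vi = ∈-map⁻ v x∈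
                in ∈-deduplicate⁺ _≟³_ (subst (_∈ map v L) (sym x≡vi) (∈-map⁺ v (every i)))))))

Box⇒InBall : ∀ {m B} u → 3 * (B * B) ≤ m * m → Box B u → InBall m u
Box⇒InBall {m} {B} (x , y , z) 3B²≤m² (x≤ , y≤ , z≤) =
  subst (ℤ._≤ + (m * m)) (sym (cong₂ ℤ._+_ (cong₂ ℤ._+_ (square-abs x) (square-abs y))
    (square-abs z)))
    (+≤+ (ℕP.≤-trans (ℕP.+-mono-≤ (ℕP.+-mono-≤ (ℕP.*-mono-≤ x≤ x≤) (ℕP.*-mono-≤ y≤ y≤))
      (ℕP.*-mono-≤ z≤ z≤))
      (ℕP.≤-trans (ℕP.≤-reflexive (thrice (B * B))) 3B²≤m²)))
  where
  thrice : ∀ k → k + k + k ≡ 3 * k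
  thrice = solveℕ 1 (λ k → k ⊕ k ⊕ k ⊜ conℕ 3 ⊗ k) refl

∣-n∣≤1+n : ∀ n → ∣ ℤ.- + n ∣ ≤ suc n
∣-n∣≤1+n n = ℕP.≤-trans (ℕP.≤-reflexive (ℤP.∣-i∣≡∣i∣ (+ n))) (ℕP.n≤1+n n)

tetrahedron-box : ∀ n i → Box (suc n) (tetrahedron n i)
tetrahedron-box n 0F = ℕP.n≤1+n n , ℕP.n≤1+n n , ℕP.≤-refl
tetrahedron-box n 1F = ∣-n∣≤1+n n , ℕP.n≤1+n n , ℕP.≤-refl
tetrahedron-box n 2F = ℕP.≤-refl , ∣-n∣≤1+n n , ∣-n∣≤1+n n
tetrahedron-box n 3F = ∣-n∣≤1+n n , ℕP.≤-refl , ℕP.≤-refl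

tetrahedron-unique : ∀ n .{{_ : ℕ.NonZero n}} → Unique (map (tetrahedron n) (List.allFin 4))
-- For a successor the signs of all entries compute, and absurd patterns separate the vectors.
tetrahedron-unique (suc n) =
  ((λ ()) ∷ (λ ()) ∷ (λ ()) ∷ []) ∷ ((λ ()) ∷ (λ ()) ∷ []) ∷ ((λ ()) ∷ []) ∷ [] ∷ []

cubic≤horner : ∀ c d e n → n * (n * (n * 4)) ≤ horner c d e n
cubic≤horner c d e n = ℕP.≤-trans (ℕP.*-monoʳ-≤ n
  (ℕP.≤-trans (ℕP.*-monoʳ-≤ n (ℕP.m≤n+m _ e)) (ℕP.m≤n+m _ d))) (ℕP.m≤n+m _ c)

cubic≤weight : ∀ n i → n * (n * (n * 4)) ≤ weight n i
cubic≤weight n 0F = cubic≤horner 1 2 4 n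
cubic≤weight n 1F = cubic≤horner 1 4 8 n
cubic≤weight n 2F = cubic≤horner 0 0 4 n
cubic≤weight n 3F = cubic≤horner 0 2 4 n

long-sequence : ∀ {m} n .{{_ : ℕ.NonZero n}} → 3 * (suc n * suc n) ≤ m * m →
  ∃ λ S → Admissible 4 m S × 16 * (n * n * n) ≤ length S
long-sequence {m} n 3n²≤m² =
  map v L , (AllP.map⁺ (All.universal (λ i → Box⇒InBall {m} (v i) 3n²≤m² (tetrahedron-box n i)) L) ,
             MinimalRelation⇒minimal v L (MinimalRelation-resp {weight n} {count L} {v}
               (sym ∘ count≡) (weight-minimal n)) ,
             length-support v L (tetrahedron-unique n) every) ,
  long
  where
  v = tetrahedron n
  L = proj₁ (withCounts (weight n))
  count≡ : ∀ i → count L i ≡ weight n i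
  count≡ = proj₂ (withCounts (weight n))
  positive : 0 < n * (n * (n * 4))
  positive = ℕP.*-mono-< 0<n (ℕP.*-mono-< 0<n (ℕP.*-mono-< 0<n (s≤s {n = 3} z≤n)))
    where 0<n = ℕ.>-nonZero⁻¹ n
  -- Every weight is positive, so all four vectors occur and the support has exactly four elements.
  every : ∀ i → i ∈ L
  every i = 0<count⇒∈ L (subst (0 ℕ.<_) (sym (count≡ i)) (ℕP.<-≤-trans positive (cubic≤weight n i)))
  long : 16 * (n * n * n) ≤ length (map v L)
  long = begin
    16 * (n * n * n)                   ≡⟨ solveℕ 1 (λ n → let q = n ⊗ (n ⊗ (n ⊗ conℕ 4)) in
                                                  conℕ 16 ⊗ (n ⊗ n ⊗ n) ⊜ q ⊕ q ⊕ q ⊕ q) refl n ⟩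
    Σ₄ℕ (λ _ → n * (n * (n * 4)))      ≤⟨ Σ₄-mono (cubic≤weight n) ⟩
    Σ₄ℕ (weight n)                           ≡⟨ Σ₄-cong count≡ ⟨
    Σ₄ℕ (count L)                            ≡⟨ Σ₄-count L ⟩
    length L                                 ≡⟨ ListP.length-map v L ⟨
    length (map v L)                         ∎
    where open ℕP.≤-Reasoning

-- Existence of the maximal length

-- Searches downwards from the bound `B`; the first hit is the maximum.
maximum : ∀ {P : ℕ → Set} → Decidable P → ∀ B → (∀ n → P n → n ≤ B) → ∃ P →
          ∃ λ n → P n × (∀ k → P k → k ≤ n)
maximum P? zero    P≤B (n , Pn) = n , Pn , λ k Pk → ℕP.≤-trans (P≤B k Pk) z≤n
maximum P? (suc B) P≤B ∃P with P? (suc B)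
... | yes PB = suc B , PB , P≤B
... | no ¬PB = maximum P? B (λ n Pn → ℕP.≤-pred (ℕP.≤∧≢⇒< (P≤B n Pn) λ { refl → ¬PB Pn })) ∃P

-- A sublist of `x ∷ S` either omits `x` or starts with it; the second case is the same question for
-- a shifted predicate.
allSublists? : ∀ {A : Set} {R : List A → Set} → Decidable R → ∀ S → Dec (∀ T → T ⊆ S → R T)
allSublists? R? [] = map′ (λ { R[] _ [] → R[] }) (λ all → all [] []) (R? [])
allSublists? R? (x ∷ S) = map′
  (λ { (all , all∷) T (_ ∷ʳ T⊆S) → all T T⊆S ; (all , all∷) (_ ∷ T) (refl ∷ T⊆S) → all∷ T T⊆S })
  (λ all → (λ T T⊆S → all T (x ∷ʳ T⊆S)) , (λ T T⊆S → all (x ∷ T) (refl ∷ T⊆S)))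
  (allSublists? R? S ×-dec allSublists? (λ T → R? (x ∷ T)) S)

someList? : ∀ {A : Set} (pts : List A) {Q : List A → Set} → Decidable Q → ∀ d →
            Dec (∃ λ S → All (_∈ pts) S × length S ≡ d × Q S)
someList? pts Q? zero = map′ (λ Q[] → [] , [] , refl , Q[]) (λ { ([] , _ , _ , Q[]) → Q[] }) (Q? [])
someList? pts {Q} Q? (suc d) = map′ to from (Any.any? (λ x → someList? pts (λ S → Q? (x ∷ S)) d)
  pts)
  where
  Tail = λ x → ∃ λ S → All (_∈ pts) S × length S ≡ d × Q (x ∷ S)
  to : Any Tail pts → ∃ λ S → All (_∈ pts) S × length S ≡ suc d × Q S
  to any with x , x∈ , S , S⊆ , refl , QxS ← find any =
    x ∷ S , x∈ ∷ S⊆ , refl , QxS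
  from : (∃ λ S → All (_∈ pts) S × length S ≡ suc d × Q S) → Any Tail pts
  from (x ∷ S , x∈ ∷ S⊆ , refl , QxS) = lose x∈ (S , S⊆ , refl , QxS)

interval : ℕ → List ℤ
interval m = map +_ (upTo (suc m)) ++ map -[1+_] (upTo m)

∈-interval : ∀ {m} i → ∣ i ∣ ≤ m → i ∈ interval m
∈-interval {m} (+ n)    n≤m = ∈-++⁺ˡ (∈-map⁺ +_ (∈-upTo⁺ (s≤s n≤m)))
∈-interval {m} -[1+ n ] n<m = ∈-++⁺ʳ (map +_ (upTo (suc m))) (∈-map⁺ -[1+_] (∈-upTo⁺ n<m))

box : ℕ → List ℤ³
box m = cartesianProduct (interval m) (cartesianProduct (interval m) (interval m))

InBall⇒∈box : ∀ m u → InBall m u → u ∈ box m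
InBall⇒∈box m u inBall = let x≤ , y≤ , z≤ = InBall⇒Box {m} u inBall in
  ∈-cartesianProduct⁺ (∈-interval _ x≤) (∈-cartesianProduct⁺ (∈-interval _ y≤) (∈-interval _ z≤))

empty? : ∀ {A : Set} (S : List A) → Dec (S ≡ [])
empty? []      = yes refl
empty? (_ ∷ _) = no λ ()

minimalZeroSum? : Decidable MinimalZeroSum
minimalZeroSum? S = ¬? (empty? S) ×-dec (σ S ≟³ 0³) ×-dec
  map′ (λ f T T⊆S → f T T⊆S) (λ f T T⊆S → f T T⊆S)
    (allSublists? (λ T → ¬? (empty? T) →-dec ((σ T ≟³ 0³) →-dec (length T ℕ.≟ length S))) S)

admissible? : ∀ k m → Decidable (Admissible k m)
admissible? k m S = All.all? (λ u → dot u u ℤP.≤? + (m * m)) S ×-dec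
  minimalZeroSum? S ×-dec (length (support S) ℕ.≟ k)

-- For a fixed length the search is finite, because the ball lies in the finite list `box m`.
admissibleLength? : ∀ k m → Decidable (λ d → ∃ λ S → Admissible k m S × length S ≡ d)
admissibleLength? k m d = map′
  (λ (S , _ , len , adm) → S , adm , len)
  (λ (S , adm@(inBall , _) , len) → S , All.map (λ {u} → InBall⇒∈box m u) inBall , len , adm)
  (someList? (box m) (admissible? k m) d)


-- Asymptotics

-- A crude bound, only needed as the starting point of the search in `maximum`.
length≤ : ∀ {m d} → LengthBound m d → d ≤ 256 * (m * m * (m * m) * (m * m))
length≤ {d = d} bound = ℕP.≤-trans (n≤27n² d) bound
  where
  n≤27n² : ∀ n → n ≤ 27 * (n * n)
  n≤27n² zero      = z≤n
  n≤27n² n@(suc _) = ℕP.≤-trans (ℕP.m≤m*n n n) (ℕP.m≤n*m (n * n) 27)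

-- `LengthBound` has no error term; passing from k + 1 to k + 2 only makes the inequality strict.
upper-estimate : ∀ k {m d} → 0 < m → LengthBound m d →
  27 * (suc k) ^ 2 * d ^ 2 < 256 * (k + 2) ^ 2 * m ^ 6
upper-estimate k {m} {d} 0<m bound = begin-strict
  27 * (suc k) ^ 2 * d ^ 2
    ≡⟨ solveℕ 2 (λ q d → conℕ 27 ⊗ q ⊛ 2 ⊗ d ⊛ 2 ⊜ (q ⊗ q) ⊗ (conℕ 27 ⊗ (d ⊗ d))) refl (suc k) d ⟩
  suc k * suc k * (27 * (d * d))                    ≤⟨ ℕP.*-monoʳ-≤ (suc k * suc k) bound ⟩
  suc k * suc k * X                                 <⟨ ℕP.*-monoˡ-< X {{ℕ.>-nonZero 0<X}}
        (ℕP.*-mono-< (ℕP.n<1+n (suc k)) (ℕP.n<1+n (suc k))) ⟩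
  suc (suc k) * suc (suc k) * X
    ≡⟨ solveℕ 2 (λ k m → (conℕ 2 ⊕ k) ⊗ (conℕ 2 ⊕ k) ⊗ (conℕ 256 ⊗ (m ⊗ m ⊗ (m ⊗ m) ⊗ (m ⊗ m)))
      ⊜ conℕ 256 ⊗ (k ⊕ conℕ 2) ⊛ 2 ⊗ m ⊛ 6) refl k m ⟩
  256 * (k + 2) ^ 2 * m ^ 6                         ∎
  where
  open ℕP.≤-Reasoning
  X = 256 * (m * m * (m * m) * (m * m))
  0<m² = ℕP.*-mono-< 0<m 0<m
  0<X : 0 < X
  0<X = ℕP.*-mono-< (s≤s {n = 255} z≤n) (ℕP.*-mono-< (ℕP.*-mono-< 0<m² 0<m²) 0<m²)

-- (k + 1) n³ − k (n + 2)³ = n³ − k (6 n² + 12 n + 8), and 6 + 12 + 8 = 26.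
shift-cube : ∀ k n → 26 * k < n → k * ((2 + n) * (2 + n) * (2 + n)) < suc k * (n * n * n)
shift-cube k n 26k<n = begin-strict
  k * ((2 + n) * (2 + n) * (2 + n))
    ≡⟨ solveℕ 2 (λ k n → k ⊗ ((conℕ 2 ⊕ n) ⊗ (conℕ 2 ⊕ n) ⊗ (conℕ 2 ⊕ n))
      ⊜ k ⊗ (n ⊗ n ⊗ n) ⊕ k ⊗ (conℕ 6 ⊗ (n ⊗ n) ⊕ conℕ 12 ⊗ n ⊕ conℕ 8)) refl k n ⟩
  k * (n * n * n) + k * (6 * (n * n) + 12 * n + 8)
    ≤⟨ ℕP.+-monoʳ-≤ (k * (n * n * n)) (ℕP.*-monoʳ-≤ k
      (ℕP.+-mono-≤ (ℕP.+-monoʳ-≤ (6 * (n * n)) (ℕP.*-monoʳ-≤ 12 (ℕP.m≤m*n n n)))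
      (ℕP.*-monoʳ-≤ 8 (ℕP.*-mono-≤ 0<n 0<n)))) ⟩
  k * (n * n * n) + k * (6 * (n * n) + 12 * (n * n) + 8 * (n * n))
    ≡⟨ solveℕ 2 (λ k n → k ⊗ (n ⊗ n ⊗ n) ⊕ k ⊗ (conℕ 6 ⊗ (n ⊗ n) ⊕ conℕ 12 ⊗ (n ⊗ n) ⊕ conℕ
      8 ⊗ (n ⊗ n))
      ⊜ k ⊗ (n ⊗ n ⊗ n) ⊕ conℕ 26 ⊗ k ⊗ (n ⊗ n)) refl k n ⟩
  k * (n * n * n) + 26 * k * (n * n)
    <⟨ ℕP.+-monoʳ-< (k * (n * n * n)) (ℕP.*-monoˡ-< (n * n) 26k<n) ⟩
  k * (n * n * n) + n * (n * n)
    ≡⟨ solveℕ 2 (λ k n → k ⊗ (n ⊗ n ⊗ n) ⊕ n ⊗ (n ⊗ n) ⊜ (conℕ 1 ⊕ k) ⊗ (n ⊗ n ⊗ n)) refl k n ⟩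
  suc k * (n * n * n) ∎
  where
  open ℕP.≤-Reasoning
  0<n = ℕP.≤-<-trans z≤n 26k<n
  instance n≢0 : ℕ.NonZero n
           n≢0 = ℕ.>-nonZero 0<n
           n²≢0 : ℕ.NonZero (n * n)
           n²≢0 = ℕ.>-nonZero (ℕP.*-mono-< 0<n 0<n)

-- With N = n + 2, m⁶ ≤ 27 N⁶ and d² ≥ 256 n⁶, so it is enough to compare k N³ with (k + 1) n³; that
-- is `shift-cube`.
lower-estimate : ∀ k {m d n} → 26 * k < n → m * m ≤ 3 * ((2 + n) * (2 + n)) → 16 * (n * n * n) ≤ d →
  256 * k ^ 2 * m ^ 6 < 27 * (suc k) ^ 2 * d ^ 2
lower-estimate k {m} {d} {n} 26k<n m²≤ long = begin-strict
  256 * k ^ 2 * m ^ 6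
    ≡⟨ solveℕ 2 (λ k m → conℕ 256 ⊗ k ⊛ 2 ⊗ m ⊛ 6
      ⊜ conℕ 256 ⊗ (k ⊗ k) ⊗ (m ⊗ m ⊗ (m ⊗ m) ⊗ (m ⊗ m))) refl k m ⟩
  256 * (k * k) * (m * m * (m * m) * (m * m))
    ≤⟨ ℕP.*-monoʳ-≤ (256 * (k * k)) (ℕP.*-mono-≤ (ℕP.*-mono-≤ m²≤ m²≤) m²≤) ⟩
  256 * (k * k) * (3 * (N * N) * (3 * (N * N)) * (3 * (N * N)))
    ≡⟨ solveℕ 2 (λ k N →
      conℕ 256 ⊗ (k ⊗ k) ⊗ (conℕ 3 ⊗ (N ⊗ N) ⊗ (conℕ 3 ⊗ (N ⊗ N)) ⊗ (conℕ 3 ⊗ (N ⊗ N)))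
      ⊜ conℕ (27 * 256) ⊗ (k ⊗ (N ⊗ N ⊗ N) ⊗ (k ⊗ (N ⊗ N ⊗ N)))) refl k N ⟩
  27 * 256 * (k * (N * N * N) * (k * (N * N * N)))
    <⟨ ℕP.*-monoʳ-< (27 * 256) (ℕP.*-mono-< (shift-cube k n 26k<n) (shift-cube k n 26k<n)) ⟩
  27 * 256 * (suc k * (n * n * n) * (suc k * (n * n * n)))
    ≡⟨ solveℕ 2 (λ q c → conℕ (27 * 256) ⊗ (q ⊗ c ⊗ (q ⊗ c))
      ⊜ conℕ 27 ⊗ q ⊛ 2 ⊗ (conℕ 16 ⊗ c) ⊛ 2) refl (suc k) (n * n * n) ⟩
  27 * (suc k) ^ 2 * (16 * (n * n * n)) ^ 2
    ≤⟨ ℕP.*-monoʳ-≤ (27 * (suc k) ^ 2) (ℕP.^-monoˡ-≤ 2 long) ⟩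
  27 * (suc k) ^ 2 * d ^ 2 ∎
  where
  open ℕP.≤-Reasoning
  N = 2 + n

largest-scale : ∀ n₀ m → 3 * (suc n₀ * suc n₀) ≤ m * m →
  ∃ λ n → n₀ ≤ n × 3 * (suc n * suc n) ≤ m * m × m * m ≤ 3 * ((2 + n) * (2 + n))
largest-scale n₀ m fits =
  -- The largest fitting `n` is taken; that `n + 1` no longer fits is the last inequality. The
  -- search is bounded because n ≤ 3 (n + 1)² ≤ m².
  let n , n-fits , largest = maximum (λ n → 3 * (suc n * suc n) ℕ.≤? m * m) (m * m)
        (λ n n-fits → ℕP.≤-trans (ℕP.n≤1+n n) (ℕP.≤-trans (ℕP.m≤m*n (suc n) (suc n))
          (ℕP.≤-trans (ℕP.m≤n*m (suc n * suc n) 3) n-fits)))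
        (n₀ , fits)
  in n , largest n₀ fits , n-fits , ℕP.<⇒≤ (ℕP.≰⇒> λ fits′ → ℕP.<⇒≱ (ℕP.n<1+n n)
    (largest (suc n) fits′))

-- Let r be the ratio of d to 16 m³ / (3√3), so that r² = 27 d² / (256 m⁶). The two inequalities are
-- the squared forms of k / (k + 1) < r < (k + 2) / (k + 1), that is |r - 1| < 1 / (k + 1).
theorem7 : (k : ℕ) → Σ ℕ λ M → (m : ℕ) → m ≥ M →
    Σ ℕ λ d → IsDk 4 m d ×
    (256 * k ^ 2 * m ^ 6 < 27 * (suc k) ^ 2 * d ^ 2) ×
    (27 * (suc k) ^ 2 * d ^ 2 < 256 * (k + 2) ^ 2 * m ^ 6)
-- The summand 106 serves the upper bound. The other one makes the tetrahedron of scale `n₀` fit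
-- into the ball, with 2 in place of √3.
theorem7 k = 106 + 2 * suc n₀ , λ m m≥M →
  let 106≤m = ℕP.m+n≤o⇒m≤o 106 m≥M
      n , n₀≤n , fits , m²≤ = largest-scale n₀ m (scale-fits (ℕP.m+n≤o⇒n≤o 106 m≥M))
      S , S-admissible , long = long-sequence {m} n {{ℕ.>-nonZero (ℕP.≤-trans (s≤s z≤n) n₀≤n)}} fits
      bounded : ∀ S → Admissible 4 m S → LengthBound m (length S)
      bounded S = Admissible⇒bound {m} S 106≤m
      d , ∃S@(T , T-admissible , |T|≡d) , largest = maximum (admissibleLength? 4 m)
        (256 * (m * m * (m * m) * (m * m)))
        (λ { _ (S , adm , refl) → length≤ {m} (bounded S adm) })
          (length S , S , S-admissible , refl)
  in d , (∃S , λ S adm → largest (length S) (S , adm , refl)) ,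
     lower-estimate k {m} {d} {n} n₀≤n m²≤ (ℕP.≤-trans long
       (largest (length S) (S , S-admissible , refl))) ,
     upper-estimate k {m} {d} (ℕP.≤-trans (s≤s z≤n) 106≤m)
       (subst (LengthBound m) |T|≡d (bounded T T-admissible))
  where
  -- Chosen so that `n₀ ≤ n` is by definition the hypothesis `26 * k < n` of `lower-estimate`.
  n₀ = suc (26 * k)
  scale-fits : ∀ {m} → 2 * suc n₀ ≤ m → 3 * (suc n₀ * suc n₀) ≤ m * m
  scale-fits {m} 2n≤m = begin
    3 * (suc n₀ * suc n₀)              ≤⟨ ℕP.m≤n+m _ (suc n₀ * suc n₀) ⟩
    4 * (suc n₀ * suc n₀)
      ≡⟨ solveℕ 1 (λ n → conℕ 4 ⊗ (n ⊗ n) ⊜ conℕ 2 ⊗ n ⊗ (conℕ 2 ⊗ n)) refl (suc n₀) ⟩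
    2 * suc n₀ * (2 * suc n₀)          ≤⟨ ℕP.*-mono-≤ 2n≤m 2n≤m ⟩
    m * m                              ∎
    where open ℕP.≤-Reasoning
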